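{- Let $m\ge 2$ and let $\gamma=\gamma_1\cdots\gamma_m\in\mathcal S_m(132)$ with $\gamma_1=m-1$ and $\gamma_m=m$. Let $B=B(t,x)=\sum_{n\ge 0}t^n\sum_{\sigma\in\mathcal S_n(132)}x^{\gamma\text{ -mch}(\sigma)}$. Then $$B=\frac{1+t^{m-1}(x-1)(B^2-B)}{1-tB}.$$
   Context: $\mathcal S_n$ is the set of permutations of $\{1,\dots,n\}$ in one-line notation ($\mathcal S_0$ contains only the empty permutation, on which all statistics are $0$). For a word $w$ of distinct integers, $\mathrm{red}(w)$ replaces the $i$-th smallest letter by $i$. $\sigma\in\mathcal S_n$ avoids $\lambda\in\mathcal S_k$ (classical avoidance) if no (not necessarily contiguous) subsequence $\sigma_{i_1}\cdots\sigma_{i_k}$, $i_1<\dots<i_k$, has reduction $\lambda$; $\mathcal S_n(\lambda)$ is the set of such $\sigma$. $\gamma\text{ -mch}(\sigma)$ is the number of $i$ with $\mathrm{red}(\sigma_i\sigma_{i+1}\cdots\sigma_{i+k-1})=\gamma$ for $\gamma\in\mathcal S_k$. The identity is one of formal power series in $t$ over $\mathbb Q[x]$. -}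

module Defs where

open import Algebra.Bundles.Raw using (RawRing)
import Algebra.Definitions.RawSemiring
open import Data.List.Base
  using (List; []; _∷_; [_]; _++_; map; filter; foldr; length; take; drop; upTo; cartesianProductWith)
open import Data.List.Membership.Propositional using (_∈_; find; lose)
open import Data.List.Membership.Propositional.Properties
  using (∈-map⁺; ∈-map⁻; ∈-++⁺ˡ; ∈-++⁺ʳ; ∈-++⁻)
open import Data.List.Properties using (≡-dec)
open import Data.List.Relation.Binary.Sublist.Propositional using (_⊆_; []; _∷_; _∷ʳ_)
open import Data.List.Relation.Unary.Any using (any?; here)
open import Data.Nat.Base using (ℕ; zero; suc; _∸_)
open import Data.Nat.Properties using (_≟_; _<?_)
open import Data.List.Relation.Unary.Unique.DecPropositional _≟_ using (unique?)
open import Data.Product.Base using (∃-syntax; _×_; _,_)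
import Data.Rational.Base as ℚ
open import Data.Sum.Base using (inj₁; inj₂)
open import Level using (0ℓ)
open import Relation.Binary.Definitions using (DecidableEquality)
open import Relation.Binary.PropositionalEquality.Core using (_≡_; refl)
open import Relation.Nullary.Decidable.Core using (Dec; map′; ¬?)
open import Relation.Nullary.Negation.Core using (¬_)

------------------------------------------------------------------------
-- Words and permutations

Word : Set
Word = List ℕ

_≟ᵂ_ : DecidableEquality Word
_≟ᵂ_ = ≡-dec _≟_

-- The i-th smallest letter of a word of distinct letters has exactly
-- i - 1 letters below it.
red : Word → Word
red w = map (λ a → suc (length (filter (_<? a) w))) w

words : Word → ℕ → List Word
words A zero    = [ [] ]
words A (suc k) = cartesianProductWith _∷_ A (words A k)

-- One-line notation: the words of length n over {1,…,n} without repeated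
-- letters, each listed once.
permutations : ℕ → List Word
permutations n = filter unique? (words (map suc (upTo n)) n)

Contains : Word → Word → Set
Contains π σ = ∃[ τ ] τ ⊆ σ × red τ ≡ π

Avoids : Word → Word → Set
Avoids π σ = ¬ Contains π σ

sublists : Word → List Word
sublists []      = [ [] ]
sublists (a ∷ w) = sublists w ++ map (a ∷_) (sublists w)

⊆⇒∈-sublists : ∀ {τ σ} → τ ⊆ σ → τ ∈ sublists σ
⊆⇒∈-sublists []         = here refl
⊆⇒∈-sublists (a ∷ʳ p)   = ∈-++⁺ˡ (⊆⇒∈-sublists p)
⊆⇒∈-sublists (refl ∷ p) = ∈-++⁺ʳ _ (∈-map⁺ _ (⊆⇒∈-sublists p))

∈-sublists⇒⊆ : ∀ σ {τ} → τ ∈ sublists σ → τ ⊆ σ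
∈-sublists⇒⊆ []      (here refl) = []
∈-sublists⇒⊆ (a ∷ σ) i with ∈-++⁻ (sublists σ) i
... | inj₁ j = a ∷ʳ ∈-sublists⇒⊆ σ j
... | inj₂ j with ∈-map⁻ (a ∷_) j
...   | _ , k , refl = refl ∷ ∈-sublists⇒⊆ σ k

contains? : ∀ π σ → Dec (Contains π σ)
contains? π σ = map′
  (λ c → let τ , i , eq = find c in τ , ∈-sublists⇒⊆ σ i , eq)
  (λ (τ , p , eq) → lose (⊆⇒∈-sublists p) eq)
  (any? (λ τ → red τ ≟ᵂ π) (sublists σ))

avoids? : ∀ π σ → Dec (Avoids π σ)
avoids? π σ = ¬? (contains? π σ)

𝒮 : ℕ → Word → List Word
𝒮 n π = filter (avoids? π) (permutations n)

windows : ℕ → Word → List Word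
windows k σ = map (λ i → take k (drop i σ)) (upTo (suc (length σ) ∸ k))

mch : Word → Word → ℕ
mch γ σ = length (filter (λ w → red w ≟ᵂ γ) (windows (length γ) σ))

------------------------------------------------------------------------
-- Sums, polynomials and formal power series

module _ {c ℓ} (R : RawRing c ℓ) where

  open RawRing R

  ∑ : ∀ {a} {A : Set a} → List A → (A → Carrier) → Carrier
  ∑ xs f = foldr _+_ 0# (map f xs)

-- A polynomial is a list of coefficients, constant term first.  Trailing
-- zeros are allowed, so equality is equality of all coefficients.
module Polynomial {c ℓ} (R : RawRing c ℓ) where

  private module R = RawRing R

  Poly : Set c
  Poly = List R.Carrier

  coeff : Poly → ℕ → R.Carrier
  coeff []      _       = R.0#
  coeff (a ∷ p) zero    = a
  coeff (a ∷ p) (suc i) = coeff p i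

  infixl 6 _+ᴾ_
  _+ᴾ_ : Poly → Poly → Poly
  []      +ᴾ q       = q
  (a ∷ p) +ᴾ []      = a ∷ p
  (a ∷ p) +ᴾ (b ∷ q) = (a R.+ b) ∷ (p +ᴾ q)

  infixl 7 _*ᴾ_
  _*ᴾ_ : Poly → Poly → Poly
  []      *ᴾ q = []
  (a ∷ p) *ᴾ q = map (a R.*_) q +ᴾ (R.0# ∷ (p *ᴾ q))

  rawRing : RawRing c ℓ
  rawRing = record
    { Carrier = Poly
    ; _≈_     = λ p q → ∀ i → coeff p i R.≈ coeff q i
    ; _+_     = _+ᴾ_
    ; _*_     = _*ᴾ_
    ; -_      = map R.-_
    ; 0#      = []
    ; 1#      = [ R.1# ]
    }

  indeterminate : Poly
  indeterminate = R.0# ∷ R.1# ∷ []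

module PowerSeries {c ℓ} (R : RawRing c ℓ) where

  private module R = RawRing R

  Series : Set c
  Series = ℕ → R.Carrier

  const : R.Carrier → Series
  const a zero    = a
  const a (suc n) = R.0#

  rawRing : RawRing c ℓ
  rawRing = record
    { Carrier = Series
    ; _≈_     = λ f g → ∀ n → f n R.≈ g n
    ; _+_     = λ f g n → f n R.+ g n
    ; _*_     = λ f g n → ∑ R (upTo (suc n)) (λ i → f i R.* g (n ∸ i))
    ; -_      = λ f n → R.- f n
    ; 0#      = const R.0#
    ; 1#      = const R.1#
    }

  indeterminate : Series
  indeterminate 1 = R.1#
  indeterminate _ = R.0#

module Ops {c ℓ} (R : RawRing c ℓ) where

  open RawRing R public
  open Algebra.Definitions.RawSemiring rawSemiring public using (_^_)

  infixl 6 _-_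
  _-_ : Carrier → Carrier → Carrier
  f - g = f + (- g)

  -- f ≈ g / h says that h is invertible and f is g times its inverse.
  infix 4 _≈_/_
  _≈_/_ : Carrier → Carrier → Carrier → Set _
  f ≈ g / h = ∃[ u ] (h * u ≈ 1#) × (f ≈ g * u)

------------------------------------------------------------------------
-- The ring ℚ[x]⟦t⟧ and the generating function

ℚ[x] : RawRing 0ℓ 0ℓ
ℚ[x] = Polynomial.rawRing ℚ.+-*-rawRing

ℚ[x]⟦t⟧ : RawRing 0ℓ 0ℓ
ℚ[x]⟦t⟧ = PowerSeries.rawRing ℚ[x]

open Ops ℚ[x]⟦t⟧ public using (Carrier; 1#; _+_; _*_; _-_; _^_; _≈_/_)

x t : Carrier
x = PowerSeries.const ℚ[x] (Polynomial.indeterminate ℚ.+-*-rawRing)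
t = PowerSeries.indeterminate ℚ[x]

B : Word → Carrier
B γ n = ∑ ℚ[x] (𝒮 n (1 ∷ 3 ∷ 2 ∷ [])) (λ σ → X ^ᴾ mch γ σ)
  where
  open Ops ℚ[x] using () renaming (_^_ to _^ᴾ_)
  X = Polynomial.indeterminate ℚ.+-*-rawRing

-- Cutting a 132-avoiding permutation after its largest letter n writes it
-- uniquely as a skew sum (L n) ⊖ R of 132-avoiding permutations.  A match
-- of γ ends with its largest letter, so it cannot meet both blocks of a skew
-- sum, and matches are counted blockwise.  Write γ = (d+1) δ (d+2), so that
-- d = m - 2.  Then L n has one match more than L exactly if L ends with a
-- word c δ′ that reduces to (d+1) δ.  In that case avoidance of 132 forces
-- the letters of δ′ to be the smallest letters of L, that is, L = L′ ⊖ δ for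
-- a nonempty L′, and L has as many matches as L′, because δ is shorter than
-- γ.  Altogether B = 1 + t (B + (x - 1) tᵈ (B - 1)) B.
module Submission where

open import Algebra.Bundles using (CommutativeRing)
open import Algebra.Consequences.Setoid using (comm∧idˡ⇒id; comm∧distrʳ⇒distr)
import Algebra.Morphism.RingMonomorphism as RingMonomorphism
open import Algebra.Morphism.Structures using (IsRingMonomorphism)
open import Data.Empty using (⊥)
open import Data.List.Base
  using ( List; []; _∷_; [_]; _++_; _∷ʳ_; map; foldr; filter; length; take; drop; upTo; applyUpTo; concatMap
        ; cartesianProduct; cartesianProductWith; initLast; _∷ʳ′_; head; last)
open import Data.List.Membership.Propositional using (_∈_; _∉_; find; lose)
open import Data.List.Membership.Propositional.Properties
open import Data.List.Membership.Propositional.Properties.WithK using (unique∧set⇒bag)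
open import Data.List.Properties
  using ( length-++; length-map; length-upTo; length-take; map-++; map-∘; map-id-local
        ; map-cong-local; map-injective; map-applyUpTo
        ; filter-++; filter-all; filter-none; filter-accept; filter-reject; take-map; take-all; take-[]; take++drop≡id
        ; ++-assoc; ++-cancelʳ; ∷-injective; ∷-injectiveˡ; ∷-injectiveʳ; ∷ʳ-injective; ∷ʳ-++)
open import Data.List.Relation.Binary.BagAndSetEquality using (∼bag⇒↭)
open import Data.List.Relation.Binary.Permutation.Propositional as ↭ using (_↭_)
open import Data.List.Relation.Binary.Sublist.Propositional
  using (_⊆_; []; _∷_; ⊆-trans; ⊆-refl; from∈; to∈)
  renaming (_∷ʳ_ to skip; lookup to ⊆-lookup)
import Data.List.Relation.Binary.Sublist.Propositional.Properties as Sublist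
open import Data.List.Relation.Unary.All as All using (All; []; _∷_)
open import Data.List.Relation.Unary.AllPairs using ([]; _∷_)
open import Data.List.Relation.Unary.Any using (here; there)
open import Data.List.Relation.Unary.Unique.DecPropositional using (unique?)
open import Data.List.Relation.Unary.Unique.Propositional using (Unique)
import Data.List.Relation.Unary.Unique.Propositional.Properties as Uniqueₚ
open import Data.Maybe.Base using (just)
open import Data.Maybe.Properties using (just-injective)
open import Data.Nat.Base as ℕ using (ℕ; zero; suc; _∸_; _≤_; _<_; z≤n; s≤s; z<s; s<s)
import Data.Nat.Properties as ℕₚ
open import Data.List.Membership.DecPropositional ℕₚ._≟_ using (_∈?_)
open import Data.Product.Base using (_,_; ∃-syntax; ∃₂; _×_; proj₁; proj₂)
import Data.Rational.Properties as ℚₚ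
open import Data.Sum.Base using (inj₁; inj₂)
open import Function.Base using (_∘_; id)
open import Function.Bundles using (mk⇔)
open import Level using (0ℓ)
open import Relation.Binary.Bundles using (Setoid)
open import Relation.Binary.PropositionalEquality as ≡ using (_≡_; _≢_; cong; cong₂; subst; subst₂; module ≡-Reasoning)
import Relation.Binary.Reasoning.Setoid as SetoidReasoning
open import Relation.Nullary.Decidable.Core using (Dec; yes; no)
open import Relation.Nullary.Negation.Core using (¬_; contradiction)
open import Relation.Unary using (Decidable; Pred)
open import Defs
  using ( Word; red; words; permutations; Avoids; avoids?; 𝒮; windows; mch; _≟ᵂ_; ∑
        ; module Ops; module PowerSeries; module Polynomial)

-- A window meeting both blocks of a skew sum contains the last letter of the upper block followed
-- by smaller letters, whereas a match of γ ends in its maximum d+2; this is why no match straddles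
-- the cut. The first letter d+1 matters as much: in a match it lies above all of δ′, so it can
-- serve as the 3 of a 132, and no letter before it may be smaller than a letter of δ′. Then δ′ is a
-- permutation of 1, ..., d, hence its own reduction, and equals δ letter for letter. That γ avoids
-- 132 enters in the converse: it makes δ, and so L′ ⊖ δ, avoid 132, so that every nonempty L′
-- occurs. The empty L′ offers no letter for d+1; it is the 1 in B - 1. Each correspondence is
-- proved as a rearrangement of duplicate-free lists, under which sums are invariant. Since series
-- and polynomials come as bare operations, their ring laws have to be established, and the quotient
-- requires an explicit inverse of 1 - tB.

private variable
  A C D : Set

-- Finite sums in a commutative ring

module Sums {c ℓ} (R : CommutativeRing c ℓ) where

  open CommutativeRing R hiding (zero)
  open SetoidReasoning setoid
  open import Algebra.Properties.CommutativeSemigroup +-commutativeSemigroup using (interchange)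

  Σ[_] : List A → (A → Carrier) → Carrier
  Σ[_] = ∑ rawRing

  ∑-cong : ∀ (xs : List A) {f g} → (∀ {y} → y ∈ xs → f y ≈ g y) → Σ[ xs ] f ≈ Σ[ xs ] g
  ∑-cong []       f≈g = refl
  ∑-cong (y ∷ xs) f≈g = +-cong (f≈g (here ≡.refl)) (∑-cong xs (f≈g ∘ there))

  ∑-map : ∀ (h : A → C) xs {f} → Σ[ map h xs ] f ≡ Σ[ xs ] (f ∘ h)
  ∑-map h xs {f} = ≡.cong (foldr _+_ 0#) (≡.sym (map-∘ xs))

  ∑-++ : ∀ (xs ys : List A) f → Σ[ xs ++ ys ] f ≈ Σ[ xs ] f + Σ[ ys ] f
  ∑-++ []       ys f = sym (+-identityˡ _)
  ∑-++ (y ∷ xs) ys f = trans (+-congˡ (∑-++ xs ys f)) (sym (+-assoc _ _ _))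

  ∑-concatMap : ∀ (h : A → List C) xs f → Σ[ concatMap h xs ] f ≈ Σ[ xs ] (λ y → Σ[ h y ] f)
  ∑-concatMap h []       f = refl
  ∑-concatMap h (y ∷ xs) f = trans (∑-++ (h y) _ f) (+-congˡ (∑-concatMap h xs f))

  ∑-↭ : ∀ {xs ys : List A} → xs ↭ ys → ∀ f → Σ[ xs ] f ≈ Σ[ ys ] f
  ∑-↭ ↭.refl       f = refl
  ∑-↭ (↭.prep y p)   f = +-congˡ (∑-↭ p f)
  ∑-↭ (↭.swap y z p) f = trans (sym (+-assoc _ _ _))
                      (trans (+-cong (+-comm _ _) (∑-↭ p f)) (+-assoc _ _ _))
  ∑-↭ (↭.trans p q) f = trans (∑-↭ p f) (∑-↭ q f)

  ∑-+ : ∀ (xs : List A) f g → Σ[ xs ] (λ y → f y + g y) ≈ Σ[ xs ] f + Σ[ xs ] g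
  ∑-+ []       f g = sym (+-identityˡ _)
  ∑-+ (y ∷ xs) f g = trans (+-congˡ (∑-+ xs f g)) (interchange _ _ _ _)

  ∑-*ˡ : ∀ (xs : List A) k f → Σ[ xs ] (λ y → k * f y) ≈ k * Σ[ xs ] f
  ∑-*ˡ []       k f = sym (zeroʳ k)
  ∑-*ˡ (y ∷ xs) k f = trans (+-congˡ (∑-*ˡ xs k f)) (sym (distribˡ k _ _))

  -- Multiplicativity of the weight is asked on members only, because matches add up under `glue`
  -- only for 132-avoiding permutations.
  ∑-cartesianProductWith : ∀ (h : A → C → D) xs ys {f g k} →
    (∀ {y z} → y ∈ xs → z ∈ ys → k (h y z) ≈ f y * g z) →
    Σ[ cartesianProductWith h xs ys ] k ≈ Σ[ xs ] f * Σ[ ys ] g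
  ∑-cartesianProductWith h [] ys eq = sym (zeroˡ _)
  ∑-cartesianProductWith h (y ∷ xs) ys {f} {g} {k} eq = begin
    Σ[ map (h y) ys ++ cartesianProductWith h xs ys ] k
      ≈⟨ ∑-++ (map (h y) ys) _ k ⟩
    Σ[ map (h y) ys ] k + Σ[ cartesianProductWith h xs ys ] k
      ≈⟨ +-cong (reflexive (∑-map (h y) ys)) (∑-cartesianProductWith h xs ys (eq ∘ there)) ⟩
    Σ[ ys ] (k ∘ h y) + Σ[ xs ] f * Σ[ ys ] g
      ≈⟨ +-congʳ (∑-cong ys (eq (here ≡.refl))) ⟩
    Σ[ ys ] (λ z → f y * g z) + Σ[ xs ] f * Σ[ ys ] g
      ≈⟨ +-congʳ (∑-*ˡ ys (f y) g) ⟩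
    f y * Σ[ ys ] g + Σ[ xs ] f * Σ[ ys ] g
      ≈⟨ distribʳ _ _ _ ⟨
    (f y + Σ[ xs ] f) * Σ[ ys ] g ∎

  -- Shaped for a weight `f` that differs from `g` by a correction `h` exactly on the entries
  -- satisfying `P`.
  ∑-filter : ∀ {P : Pred A 0ℓ} (P? : Decidable P) xs {f g h} →
    (∀ {y} → P y → f y ≈ g y + h y) → (∀ {y} → ¬ P y → f y ≈ g y) →
    Σ[ xs ] f ≈ Σ[ xs ] g + Σ[ filter P? xs ] h
  ∑-filter P? []       yes≈ no≈ = sym (+-identityˡ _)
  ∑-filter P? (y ∷ xs) yes≈ no≈ with P? y
  ... | yes py = trans (+-cong (yes≈ py) (∑-filter P? xs yes≈ no≈)) (interchange _ _ _ _)
  ... | no ¬py = trans (+-cong (no≈ ¬py) (∑-filter P? xs yes≈ no≈)) (sym (+-assoc _ _ _))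

  ∑-upTo-suc : ∀ n f → Σ[ upTo (suc n) ] f ≡ f 0 + Σ[ upTo n ] (f ∘ suc)
  ∑-upTo-suc n f = ≡.cong (λ ys → f 0 + foldr _+_ 0# ys)
    (≡.trans (map-applyUpTo suc f n) (≡.sym (map-applyUpTo id (f ∘ suc) n)))

-- The ring of formal power series

module SeriesRing {c ℓ} (R : CommutativeRing c ℓ) where

  open CommutativeRing R hiding (zero)
  open Sums R
  open SetoidReasoning setoid
  open PowerSeries rawRing using (Series; const; indeterminate) renaming (rawRing to rawSeries)
  private
    open module S = Ops rawSeries using ()
      renaming (_≈_ to _≈ˢ_; _+_ to _+ˢ_; _*_ to _*ˢ_; 0# to 0ˢ; 1# to 1ˢ; _^_ to _^ˢ_)

  tail : Series → Series
  tail f n = f (suc n)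

  *-zeroth : ∀ f g → (f *ˢ g) 0 ≈ f 0 * g 0
  *-zeroth f g = +-identityʳ _

  -- Writing f = f 0 + t · `tail f` turns convolution into a recursion on the degree, so that the
  -- ring laws become inductions without reindexing of double sums.
  *-suc : ∀ f g n → (f *ˢ g) (suc n) ≈ f 0 * g (suc n) + (tail f *ˢ g) n
  *-suc f g n = reflexive (∑-upTo-suc (suc n) (λ i → f i * g (suc n ∸ i)))

  -- Truncated congruence is what the construction of inverses needs, where approximations agree
  -- only up to some degree.
  *-cong-≤ : ∀ n {f f′ g g′} → (∀ i → i ≤ n → f i ≈ f′ i) → (∀ i → i ≤ n → g i ≈ g′ i) → (f *ˢ g) n ≈ (f′ *ˢ g′) n
  *-cong-≤ zero {f} {f′} {g} {g′} p q = trans (*-zeroth f g) (trans (*-cong (p 0 z≤n) (q 0 z≤n)) (sym (*-zeroth f′ g′)))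
  *-cong-≤ (suc n) {f} {f′} {g} {g′} p q = begin
    (f *ˢ g) (suc n)                       ≈⟨ *-suc f g n ⟩
    f 0 * g (suc n) + (tail f *ˢ g) n      ≈⟨ +-cong (*-cong (p 0 z≤n) (q (suc n) ℕₚ.≤-refl))
                                                     (*-cong-≤ n (λ i i≤n → p (suc i) (s≤s i≤n)) (λ i i≤n → q i (ℕₚ.m≤n⇒m≤1+n i≤n))) ⟩
    f′ 0 * g′ (suc n) + (tail f′ *ˢ g′) n  ≈⟨ *-suc f′ g′ n ⟨
    (f′ *ˢ g′) (suc n)                     ∎

  *-congˢ : ∀ {f f′ g g′} → f ≈ˢ f′ → g ≈ˢ g′ → f *ˢ g ≈ˢ f′ *ˢ g′
  *-congˢ p q n = *-cong-≤ n (λ i _ → p i) (λ i _ → q i)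

  scale-* : ∀ a f g n → ((λ i → a * f i) *ˢ g) n ≈ a * (f *ˢ g) n
  scale-* a f g n = trans (∑-cong (upTo (suc n)) (λ _ → *-assoc _ _ _)) (∑-*ˡ (upTo (suc n)) a _)

  *-distribʳˢ : ∀ h f g → (f +ˢ g) *ˢ h ≈ˢ (f *ˢ h) +ˢ (g *ˢ h)
  *-distribʳˢ h f g n = trans (∑-cong (upTo (suc n)) (λ _ → distribʳ _ _ _)) (∑-+ (upTo (suc n)) _ _)

  -- The mirror image of `*-suc`, peeling the right factor; commutativity follows by playing the two
  -- recursions against each other.
  *-suc′ : ∀ f g n → (f *ˢ g) (suc n) ≈ (f *ˢ tail g) n + f (suc n) * g 0
  *-suc′ f g zero = begin
    (f *ˢ g) 1                          ≈⟨ *-suc f g 0 ⟩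
    f 0 * g 1 + (tail f *ˢ g) 0         ≈⟨ +-cong (sym (*-zeroth f (tail g))) (*-zeroth (tail f) g) ⟩
    (f *ˢ tail g) 0 + f 1 * g 0         ∎
  *-suc′ f g (suc n) = begin
    (f *ˢ g) (suc (suc n))                                           ≈⟨ *-suc f g (suc n) ⟩
    f 0 * g (suc (suc n)) + (tail f *ˢ g) (suc n)                    ≈⟨ +-congˡ (*-suc′ (tail f) g n) ⟩
    f 0 * g (suc (suc n)) + ((tail f *ˢ tail g) n + f (suc (suc n)) * g 0) ≈⟨ +-assoc _ _ _ ⟨
    f 0 * g (suc (suc n)) + (tail f *ˢ tail g) n + f (suc (suc n)) * g 0   ≈⟨ +-congʳ (*-suc f (tail g) n) ⟨
    (f *ˢ tail g) (suc n) + f (suc (suc n)) * g 0                    ∎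

  *-commˢ : ∀ f g → f *ˢ g ≈ˢ g *ˢ f
  *-commˢ f g zero    = trans (*-zeroth f g) (trans (*-comm _ _) (sym (*-zeroth g f)))
  *-commˢ f g (suc n) = begin
    (f *ˢ g) (suc n)                   ≈⟨ *-suc f g n ⟩
    f 0 * g (suc n) + (tail f *ˢ g) n  ≈⟨ +-cong (*-comm _ _) (*-commˢ (tail f) g n) ⟩
    g (suc n) * f 0 + (g *ˢ tail f) n  ≈⟨ +-comm _ _ ⟩
    (g *ˢ tail f) n + g (suc n) * f 0  ≈⟨ *-suc′ g f n ⟨
    (g *ˢ f) (suc n)                   ∎

  *-assocˢ : ∀ f g h → (f *ˢ g) *ˢ h ≈ˢ f *ˢ (g *ˢ h)
  *-assocˢ f g h zero = begin
    ((f *ˢ g) *ˢ h) 0    ≈⟨ *-zeroth (f *ˢ g) h ⟩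
    (f *ˢ g) 0 * h 0     ≈⟨ *-congʳ (*-zeroth f g) ⟩
    f 0 * g 0 * h 0      ≈⟨ *-assoc _ _ _ ⟩
    f 0 * (g 0 * h 0)    ≈⟨ *-congˡ (*-zeroth g h) ⟨
    f 0 * (g *ˢ h) 0     ≈⟨ *-zeroth f (g *ˢ h) ⟨
    (f *ˢ (g *ˢ h)) 0    ∎
  *-assocˢ f g h (suc n) = begin
    ((f *ˢ g) *ˢ h) (suc n)
      ≈⟨ *-suc (f *ˢ g) h n ⟩
    (f *ˢ g) 0 * h (suc n) + (tail (f *ˢ g) *ˢ h) n
      -- By `*-suc` in every degree, the tail of f g is f 0 times the tail of g plus the tail of f
      -- times g; induction applies to the second summand.
      ≈⟨ +-cong (*-congʳ (*-zeroth f g)) (*-congˢ (*-suc f g) (λ i → refl {h i}) n) ⟩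
    f 0 * g 0 * h (suc n) + (((λ i → f 0 * tail g i) +ˢ (tail f *ˢ g)) *ˢ h) n
      ≈⟨ +-cong (*-assoc _ _ _) (*-distribʳˢ h _ _ n) ⟩
    f 0 * (g 0 * h (suc n)) + (((λ i → f 0 * tail g i) *ˢ h) n + ((tail f *ˢ g) *ˢ h) n)
      ≈⟨ +-congˡ (+-cong (scale-* (f 0) (tail g) h n) (*-assocˢ (tail f) g h n)) ⟩
    f 0 * (g 0 * h (suc n)) + (f 0 * (tail g *ˢ h) n + (tail f *ˢ (g *ˢ h)) n)
      ≈⟨ +-assoc _ _ _ ⟨
    f 0 * (g 0 * h (suc n)) + f 0 * (tail g *ˢ h) n + (tail f *ˢ (g *ˢ h)) n
      ≈⟨ +-congʳ (distribˡ _ _ _) ⟨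
    f 0 * (g 0 * h (suc n) + (tail g *ˢ h) n) + (tail f *ˢ (g *ˢ h)) n
      ≈⟨ +-congʳ (*-congˡ (*-suc g h n)) ⟨
    f 0 * (g *ˢ h) (suc n) + (tail f *ˢ (g *ˢ h)) n
      ≈⟨ *-suc f (g *ˢ h) n ⟨
    (f *ˢ (g *ˢ h)) (suc n) ∎

  -- Zero is given as `const 0#`, whose coefficients reduce only after a case split on the degree.
  0ˢ-coeff : ∀ n → 0ˢ n ≈ 0#
  0ˢ-coeff zero    = refl
  0ˢ-coeff (suc n) = refl

  zero-*ˢ : ∀ {f} g → (∀ n → f n ≈ 0#) → ∀ n → (f *ˢ g) n ≈ 0#
  zero-*ˢ {f} g f≈0 zero    = trans (*-zeroth f g) (trans (*-congʳ (f≈0 0)) (zeroˡ _))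
  zero-*ˢ {f} g f≈0 (suc n) = begin
    (f *ˢ g) (suc n)                   ≈⟨ *-suc f g n ⟩
    f 0 * g (suc n) + (tail f *ˢ g) n  ≈⟨ +-cong (trans (*-congʳ (f≈0 0)) (zeroˡ _)) (zero-*ˢ g (f≈0 ∘ suc) n) ⟩
    0# + 0#                            ≈⟨ +-identityˡ 0# ⟩
    0#                                 ∎

  const-* : ∀ a g n → (const a *ˢ g) n ≈ a * g n
  const-* a g zero    = *-zeroth (const a) g
  const-* a g (suc n) = begin
    (const a *ˢ g) (suc n)                   ≈⟨ *-suc (const a) g n ⟩
    a * g (suc n) + (tail (const a) *ˢ g) n  ≈⟨ +-congˡ (zero-*ˢ g (λ _ → refl) n) ⟩
    a * g (suc n) + 0#                       ≈⟨ +-identityʳ _ ⟩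
    a * g (suc n)                            ∎

  seriesSetoid : Setoid c ℓ
  seriesSetoid = record
    { Carrier = Series ; _≈_ = _≈ˢ_
    ; isEquivalence = record { refl = λ _ → refl ; sym = λ p n → sym (p n) ; trans = λ p q n → trans (p n) (q n) } }

  seriesRing : CommutativeRing c ℓ
  seriesRing = record
    { isCommutativeRing = record
      { isRing = record
        { +-isAbelianGroup = record
          { isGroup = record
            { isMonoid = record
              { isSemigroup = record
                { isMagma = record { isEquivalence = Setoid.isEquivalence seriesSetoid ; ∙-cong = λ p q n → +-cong (p n) (q n) }
                ; assoc   = λ f g h n → +-assoc _ _ _
                }
              ; identity = (λ f n → trans (+-congʳ (0ˢ-coeff n)) (+-identityˡ _))
                         , (λ f n → trans (+-congˡ (0ˢ-coeff n)) (+-identityʳ _))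
              }
            ; inverse = (λ f n → trans (-‿inverseˡ _) (sym (0ˢ-coeff n)))
                      , (λ f n → trans (-‿inverseʳ _) (sym (0ˢ-coeff n)))
            ; ⁻¹-cong = λ p n → -‿cong (p n)
            }
          ; comm = λ f g n → +-comm _ _
          }
        ; *-cong     = *-congˢ
        ; *-assoc    = *-assocˢ
        ; *-identity = comm∧idˡ⇒id seriesSetoid *-commˢ (λ f n → trans (const-* 1# f n) (*-identityˡ _))
        ; distrib    = comm∧distrʳ⇒distr seriesSetoid (λ p q n → +-cong (p n) (q n)) *-commˢ *-distribʳˢ
        }
      ; *-comm = *-commˢ
      }
    }

  t-*-zero : ∀ f → (indeterminate *ˢ f) 0 ≈ 0#
  t-*-zero f = trans (*-zeroth indeterminate f) (zeroˡ _)

  t-*-suc : ∀ f n → (indeterminate *ˢ f) (suc n) ≈ f n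
  t-*-suc f n = begin
    (indeterminate *ˢ f) (suc n)                      ≈⟨ *-suc indeterminate f n ⟩
    0# * f (suc n) + (tail indeterminate *ˢ f) n      ≈⟨ +-cong (zeroˡ _) (*-congˢ tail-t (λ i → refl {f i}) n) ⟩
    0# + (1ˢ *ˢ f) n                                  ≈⟨ +-identityˡ _ ⟩
    (1ˢ *ˢ f) n                                       ≈⟨ const-* 1# f n ⟩
    1# * f n                                          ≈⟨ *-identityˡ _ ⟩
    f n                                               ∎
    where
    tail-t : tail indeterminate ≈ˢ 1ˢ
    tail-t zero    = refl
    tail-t (suc n) = refl

  t^-suc : ∀ d f → (indeterminate ^ˢ suc d) *ˢ f ≈ˢ indeterminate *ˢ ((indeterminate ^ˢ d) *ˢ f)
  t^-suc d f = *-assocˢ indeterminate (indeterminate ^ˢ d) f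

  t^-high : ∀ f d j → ((indeterminate ^ˢ d) *ˢ f) (j ℕ.+ d) ≈ f j
  t^-high f zero    j rewrite ℕₚ.+-identityʳ j = trans (const-* 1# f j) (*-identityˡ (f j))
  t^-high f (suc d) j rewrite ℕₚ.+-suc j d =
    trans (t^-suc d f (suc (j ℕ.+ d))) (trans (t-*-suc ((indeterminate ^ˢ d) *ˢ f) (j ℕ.+ d)) (t^-high f d j))

  -- The range includes degree `d` itself, where the coefficient is f 0; hence the assumption that
  -- it vanishes.
  t^-low : ∀ f → f 0 ≈ 0# → ∀ d n → n ≤ d → ((indeterminate ^ˢ d) *ˢ f) n ≈ 0#
  t^-low f f0≈0 zero    zero    _         = trans (t^-high f 0 0) f0≈0
  t^-low f f0≈0 (suc d) zero    _         = trans (t^-suc d f 0) (t-*-zero ((indeterminate ^ˢ d) *ˢ f))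
  t^-low f f0≈0 (suc d) (suc n) (s≤s n≤d) =
    trans (t^-suc d f (suc n)) (trans (t-*-suc ((indeterminate ^ˢ d) *ˢ f) n) (t^-low f f0≈0 d n n≤d))

-- Invertibility of 1 - t f

module Inverse {c ℓ} (R : CommutativeRing c ℓ) where

  open CommutativeRing R hiding (zero)
  open SeriesRing R
  private module S = CommutativeRing seriesRing
  open PowerSeries rawRing using (Series; indeterminate)

  -- geometric f k agrees with the inverse of 1 - t f up to degree k, so
  -- that the inverse is read off the diagonal.
  geometric : Series → ℕ → Series
  geometric f zero    = S.1#
  geometric f (suc k) = S.1# S.+ indeterminate S.* (f S.* geometric f k)

  -- Every pass through the recursion puts a factor t in front, so each step of the induction gains
  -- one degree of agreement.
  geometric-stable : ∀ f k n → n ≤ k → geometric f (suc k) n ≈ geometric f k n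
  geometric-stable f zero zero n≤k = trans (+-congˡ (t-*-zero (f S.* S.1#))) (+-identityʳ 1#)
  geometric-stable f (suc k) zero n≤k = +-congˡ (trans (t-*-zero (f S.* geometric f (suc k))) (sym (t-*-zero (f S.* geometric f k))))
  geometric-stable f (suc k) (suc n) (s≤s n≤k) = +-congˡ
    (trans (t-*-suc (f S.* geometric f (suc k)) n)
    (trans (*-cong-≤ n (λ _ _ → refl) (λ i i≤n → geometric-stable f k i (ℕₚ.≤-trans i≤n n≤k)))
           (sym (t-*-suc (f S.* geometric f k) n))))

  geometric-diagonal : ∀ f k n → n ≤ k → geometric f k n ≈ geometric f n n
  geometric-diagonal f k n n≤k with ℕₚ.m≤n⇒∃[o]m+o≡n n≤k
  ... | o , ≡.refl = go o
    where
    go : ∀ o → geometric f (n ℕ.+ o) n ≈ geometric f n n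
    go zero    rewrite ℕₚ.+-identityʳ n = refl
    go (suc o) rewrite ℕₚ.+-suc n o =
      trans (geometric-stable f (n ℕ.+ o) n (ℕₚ.m≤m+n n o)) (go o)

  1-t*-invertible : ∀ f → ∃[ u ] (S.1# S.- indeterminate S.* f) S.* u S.≈ S.1#
  1-t*-invertible f = u , (begin
      (S.1# S.- tf) S.* u       ≈⟨ S.distribʳ u S.1# (S.- tf) ⟩
      S.1# S.* u S.+ S.- tf S.* u ≈⟨ S.+-cong (S.*-identityˡ u) (S.sym (-‿distribˡ-* tf u)) ⟩
      u S.- tf S.* u          ≈⟨ S.+-congʳ u≈ ⟩
      S.1# S.+ tf S.* u S.- tf S.* u ≈⟨ S.+-assoc S.1# _ _ ⟩
      S.1# S.+ (tf S.* u S.- tf S.* u) ≈⟨ S.+-congˡ (S.-‿inverseʳ (tf S.* u)) ⟩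
      S.1# S.+ S.0#                   ≈⟨ S.+-identityʳ S.1# ⟩
      S.1#                            ∎)
    where
    open SetoidReasoning S.setoid
    open import Algebra.Properties.Ring S.ring using (-‿distribˡ-*)
    tf u : Series
    tf = indeterminate S.* f
    u n = geometric f n n
    u≈ : u S.≈ S.1# S.+ tf S.* u
    u≈ = S.trans u≈′ (S.+-congˡ (S.sym (S.*-assoc indeterminate f u)))
      where
      u≈′ : u S.≈ S.1# S.+ indeterminate S.* (f S.* u)
      u≈′ zero    = sym (trans (+-congˡ (t-*-zero (f S.* u))) (+-identityʳ 1#))
      -- The coefficient `u (suc n)` unfolds to the recursion through `geometric f n`; only
      -- coefficients of the latter up to degree `n` enter, and those agree with `u`.
      u≈′ (suc n) = +-congˡ (trans (t-*-suc (f S.* geometric f n) n) (trans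
        (*-cong-≤ n (λ _ _ → refl) (λ i i≤n → geometric-diagonal f n i i≤n))
        (sym (t-*-suc (f S.* u) n))))

-- The polynomial ring as a subring of the power series ring

module PolynomialRing {c ℓ} (R : CommutativeRing c ℓ) where

  open CommutativeRing R hiding (zero)
  open SeriesRing R
  open SetoidReasoning setoid
  private module S = CommutativeRing seriesRing
  open Polynomial rawRing using (Poly; coeff; _+ᴾ_; _*ᴾ_) renaming (rawRing to rawPoly)

  coeff-+ : ∀ p q n → coeff (p +ᴾ q) n ≈ coeff p n + coeff q n
  coeff-+ []      q       n       = sym (+-identityˡ _)
  coeff-+ (a ∷ p) []      n       = sym (+-identityʳ _)
  coeff-+ (a ∷ p) (b ∷ q) zero    = refl
  coeff-+ (a ∷ p) (b ∷ q) (suc n) = coeff-+ p q n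

  coeff-scale : ∀ a q n → coeff (map (a *_) q) n ≈ a * coeff q n
  coeff-scale a []      n       = sym (zeroʳ a)
  coeff-scale a (b ∷ q) zero    = refl
  coeff-scale a (b ∷ q) (suc n) = coeff-scale a q n

  coeff-neg : ∀ q n → coeff (map -_ q) n ≈ - coeff q n
  coeff-neg []      n       = sym -0#≈0#
    where open import Algebra.Properties.Ring ring using (-0#≈0#)
  coeff-neg (b ∷ q) zero    = refl
  coeff-neg (b ∷ q) (suc n) = coeff-neg q n

  coeff-* : ∀ p q n → coeff (p *ᴾ q) n ≈ (coeff p S.* coeff q) n
  coeff-* []      q n    = sym (zero-*ˢ (coeff q) (λ _ → refl) n)
  coeff-* (a ∷ p) q zero = begin
    coeff (map (a *_) q +ᴾ (0# ∷ p *ᴾ q)) 0 ≈⟨ coeff-+ (map (a *_) q) _ 0 ⟩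
    coeff (map (a *_) q) 0 + 0#             ≈⟨ +-identityʳ _ ⟩
    coeff (map (a *_) q) 0                  ≈⟨ coeff-scale a q 0 ⟩
    a * coeff q 0                           ≈⟨ *-zeroth (coeff (a ∷ p)) (coeff q) ⟨
    (coeff (a ∷ p) S.* coeff q) 0           ∎
  coeff-* (a ∷ p) q (suc n) = begin
    coeff (map (a *_) q +ᴾ (0# ∷ p *ᴾ q)) (suc n)       ≈⟨ coeff-+ (map (a *_) q) _ (suc n) ⟩
    coeff (map (a *_) q) (suc n) + coeff (p *ᴾ q) n     ≈⟨ +-cong (coeff-scale a q (suc n)) (coeff-* p q n) ⟩
    a * coeff q (suc n) + (coeff p S.* coeff q) n       ≈⟨ *-suc (coeff (a ∷ p)) (coeff q) n ⟨
    (coeff (a ∷ p) S.* coeff q) (suc n)                 ∎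

  -- Equality of polynomials is by definition equality of their coefficient series, so injectivity
  -- is the identity, and all ring laws can be pulled back from series.
  coeff-isRingMonomorphism : IsRingMonomorphism rawPoly S.rawRing coeff
  coeff-isRingMonomorphism = record
    { isRingHomomorphism = record
      { isSemiringHomomorphism = record
        { isNearSemiringHomomorphism = record
          { +-isMonoidHomomorphism = record
            { isMagmaHomomorphism = record
              { isRelHomomorphism = record { cong = id }
              ; homo = coeff-+
              }
            ; ε-homo = λ n → sym (0ˢ-coeff n)
            }
          ; *-homo = coeff-*
          }
        ; 1#-homo = λ { zero → refl ; (suc n) → refl }
        }
      ; -‿homo = coeff-neg
      }
    ; injective = id
    }

  polynomialRing : CommutativeRing c ℓ
  polynomialRing = record
    { isCommutativeRing = RingMonomorphism.isCommutativeRing coeff-isRingMonomorphism S.isCommutativeRing }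

-- From the recursive equation to the quotient

module _ {c ℓ} (R : CommutativeRing c ℓ) where

  open CommutativeRing R hiding (zero)
  open Ops rawRing using (_^_; _≈_/_)
  open SetoidReasoning setoid
  open import Algebra.Properties.Ring ring using (-‿distribˡ-*; -‿distribʳ-*)
  open import Algebra.Solver.CommutativeMonoid *-commutativeMonoid using (solve; _⊕_; _⊜_)

  -- Here `T` stands for t^d. Multiplied out, the right side contains b (t b); moved to the left it
  -- gives b (1 - t b), and the inverse `u` then isolates b.
  solve-quadratic : ∀ {t x T b u} →
    b ≈ 1# + t * ((b + (x - 1#) * (T * (b - 1#))) * b) →
    (1# - t * b) * u ≈ 1# →
    b ≈ (1# + (t * T) * (x - 1#) * (b ^ 2 - b)) / (1# - t * b)
  solve-quadratic {t} {x} {T} {b} {u} eq inv = u , inv , (begin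
    b                       ≈⟨ *-identityʳ b ⟨
    b * 1#                  ≈⟨ *-congˡ inv ⟨
    b * ((1# - t * b) * u)  ≈⟨ *-assoc _ _ _ ⟨
    b * (1# - t * b) * u    ≈⟨ *-congʳ cleared ⟩
    N * u                   ∎)
    where
    N q : Carrier
    q = b ^ 2 - b
    N = 1# + (t * T) * (x - 1#) * q

    [b-1]b : (b - 1#) * b ≈ q
    [b-1]b = trans (distribʳ b b (- 1#))
      -- The power `b ^ 2` unfolds to b * (b * 1#), hence the identity law.
      (+-cong (*-congˡ (sym (*-identityʳ b)))
              (trans (sym (-‿distribˡ-* 1# b)) (-‿cong (*-identityˡ b))))

    expanded : b ≈ N + b * (t * b)
    expanded = begin
      b
        ≈⟨ eq ⟩
      1# + t * ((b + (x - 1#) * (T * (b - 1#))) * b)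
        ≈⟨ +-congˡ (*-congˡ (distribʳ _ _ _)) ⟩
      1# + t * (b * b + (x - 1#) * (T * (b - 1#)) * b)
        ≈⟨ +-congˡ (distribˡ _ _ _) ⟩
      1# + (t * (b * b) + t * ((x - 1#) * (T * (b - 1#)) * b))
        ≈⟨ +-congˡ (+-comm _ _) ⟩
      1# + (t * ((x - 1#) * (T * (b - 1#)) * b) + t * (b * b))
        ≈⟨ +-assoc _ _ _ ⟨
      1# + t * ((x - 1#) * (T * (b - 1#)) * b) + t * (b * b)
        ≈⟨ +-cong (+-congˡ (solve 5 (λ t y T z b → t ⊕ ((y ⊕ (T ⊕ z)) ⊕ b) ⊜ ((t ⊕ T) ⊕ y) ⊕ (z ⊕ b)) refl t (x - 1#) T (b - 1#) b))
                  (solve 2 (λ t b → t ⊕ (b ⊕ b) ⊜ b ⊕ (t ⊕ b)) refl t b) ⟩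
      1# + (t * T) * (x - 1#) * ((b - 1#) * b) + b * (t * b)
        ≈⟨ +-congʳ (+-congˡ (*-congˡ [b-1]b)) ⟩
      N + b * (t * b) ∎

    cleared : b * (1# - t * b) ≈ N
    cleared = begin
      b * (1# - t * b)                    ≈⟨ distribˡ _ _ _ ⟩
      b * 1# + b * - (t * b)              ≈⟨ +-cong (*-identityʳ b) (sym (-‿distribʳ-* b (t * b))) ⟩
      b - b * (t * b)                     ≈⟨ +-congʳ expanded ⟩
      N + b * (t * b) - b * (t * b)       ≈⟨ +-assoc _ _ _ ⟩
      N + (b * (t * b) - b * (t * b))     ≈⟨ +-congˡ (-‿inverseʳ _) ⟩
      N + 0#                              ≈⟨ +-identityʳ N ⟩
      N                                   ∎

-- Permutations, reduction and 132-avoidance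

module PatternAvoidance where

  open import Data.Nat.Base using (_+_)
  open ℕₚ
  open ≡ using (refl; sym; trans)

  Unique-⊆ : ∀ {τ σ : List A} → τ ⊆ σ → Unique σ → Unique τ
  Unique-⊆ []         []       = []
  Unique-⊆ (skip _ p)   (_ ∷ σ!) = Unique-⊆ p σ!
  Unique-⊆ (refl ∷ p) (a∉ ∷ σ!) = Sublist.All-resp-⊆ p a∉ ∷ Unique-⊆ p σ!

  ∈-pair⊆ : ∀ {a b : A} {u v} → a ∈ u → b ∈ v → a ∷ [ b ] ⊆ u ++ v
  ∈-pair⊆ a∈u b∈v = Sublist.++⁺ (from∈ a∈u) (from∈ b∈v)

  Unique-++⇒≢ : ∀ {a b : A} u {v} → Unique (u ++ v) → a ∈ u → b ∈ v → a ≢ b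
  Unique-++⇒≢ u uv! a∈u b∈v with Unique-⊆ (∈-pair⊆ a∈u b∈v) uv!
  ... | (a≢b ∷ []) ∷ _ = a≢b

  length-∷ʳ : ∀ (w : List A) a → length (w ∷ʳ a) ≡ suc (length w)
  length-∷ʳ w a = trans (length-++ w) (+-comm (length w) 1)

  -- The pigeonhole principle. Applied to `interval`, it provides the counting facts about
  -- permutations: no gaps, ranks, and the ranges of the blocks of a skew sum.
  Unique-⊆⇒length≤ : ∀ {xs ys : List A} → Unique xs → (∀ {a} → a ∈ xs → a ∈ ys) → length xs ≤ length ys
  Unique-⊆⇒length≤ {xs = []}     _          xs⊆ys = z≤n
  Unique-⊆⇒length≤ {xs = x ∷ xs} (x∉ ∷ xs!) xs⊆ys with ∈-∃++ (xs⊆ys (here refl))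
  ... | us , vs , refl = ≤-trans (s≤s (Unique-⊆⇒length≤ xs! rest)) (≤-reflexive eq)
    where
    rest : ∀ {a} → a ∈ xs → a ∈ us ++ vs
    rest a∈xs with ∈-++⁻ us (xs⊆ys (there a∈xs))
    ... | inj₁ a∈us           = ∈-++⁺ˡ a∈us
    ... | inj₂ (here refl)    = contradiction refl (All.lookup x∉ a∈xs)
    ... | inj₂ (there a∈vs)   = ∈-++⁺ʳ us a∈vs
    eq : suc (length (us ++ vs)) ≡ length (us ++ x ∷ vs)
    eq = trans (cong suc (length-++ us)) (trans (sym (+-suc (length us) (length vs))) (sym (length-++ us)))

  interval : ℕ → Word
  interval n = map suc (upTo n)

  length-interval : ∀ n → length (interval n) ≡ n
  length-interval n = trans (length-map suc (upTo n)) (length-upTo n)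

  interval-unique : ∀ n → Unique (interval n)
  interval-unique n = Uniqueₚ.map⁺ suc-injective (Uniqueₚ.upTo⁺ n)

  ∈-interval⁺ : ∀ {n a} → 0 < a → a ≤ n → a ∈ interval n
  ∈-interval⁺ {a = suc a} _ a<n = ∈-map⁺ suc (∈-upTo⁺ a<n)

  ∈-interval⁻ : ∀ {n a} → a ∈ interval n → 0 < a × a ≤ n
  ∈-interval⁻ a∈ with ∈-map⁻ suc a∈
  ... | _ , i∈ , refl = z<s , ∈-upTo⁻ i∈

  -- Surjectivity onto 1, ..., n is recovered from these fields by counting, in `IsPerm-complete`.
  record IsPerm (n : ℕ) (σ : Word) : Set where
    field
      length≡ : length σ ≡ n
      unique  : Unique σ
      bounds  : ∀ {a} → a ∈ σ → 0 < a × a ≤ n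

    positive : ∀ {a} → a ∈ σ → 0 < a
    positive = proj₁ ∘ bounds

    bounded : ∀ {a} → a ∈ σ → a ≤ n
    bounded = proj₂ ∘ bounds

  open IsPerm

  -- If `a` were missing, `a ∷ σ` would be n + 1 distinct letters in an interval of size n.
  IsPerm-complete : ∀ {n σ a} → IsPerm n σ → 0 < a → a ≤ n → a ∈ σ
  IsPerm-complete {n} {σ} {a} p 0<a a≤n with a ∈? σ
  ... | yes a∈σ = a∈σ
  ... | no  a∉σ = contradiction
    (≤-trans (Unique-⊆⇒length≤ (All.tabulate (λ b∈σ a≡b → a∉σ (subst (_∈ σ) (sym a≡b) b∈σ)) ∷ unique p) incl)
             (≤-reflexive (length-interval n)))
    (<⇒≱ (s≤s (≤-reflexive (sym (length≡ p)))))
    where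
    incl : ∀ {b} → b ∈ a ∷ σ → b ∈ interval n
    incl (here refl) = ∈-interval⁺ 0<a a≤n
    incl (there b∈σ) = ∈-interval⁺ (positive p b∈σ) (bounded p b∈σ)

  ∈-words⁺ : ∀ {A w} → (∀ {a} → a ∈ w → a ∈ A) → w ∈ words A (length w)
  ∈-words⁺ {w = []}    _   = here refl
  ∈-words⁺ {w = a ∷ w} w⊆A = ∈-cartesianProductWith⁺ _∷_ (w⊆A (here refl)) (∈-words⁺ (w⊆A ∘ there))

  ∈-words⁻ : ∀ {A} k {w} → w ∈ words A k → length w ≡ k × (∀ {a} → a ∈ w → a ∈ A)
  ∈-words⁻ zero (here refl) = refl , λ ()
  ∈-words⁻ {A} (suc k) w∈ with ∈-cartesianProductWith⁻ _∷_ A (words A k) w∈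
  ... | a , v , a∈A , v∈ , refl = let |v|≡k , v⊆A = ∈-words⁻ k v∈ in
    cong suc |v|≡k , λ { (here refl) → a∈A ; (there b∈v) → v⊆A b∈v }

  words-unique : ∀ {A} k → Unique A → Unique (words A k)
  words-unique zero    A! = [] ∷ []
  words-unique (suc k) A! = Uniqueₚ.cartesianProductWith⁺ _∷_ ∷-injective A! (words-unique k A!)

  ∈-permutations⁺ : ∀ {n σ} → IsPerm n σ → σ ∈ permutations n
  ∈-permutations⁺ {n} {σ} p = ∈-filter⁺ (unique? _≟_)
    (subst (λ k → σ ∈ words (interval n) k) (length≡ p)
      (∈-words⁺ (λ a∈σ → ∈-interval⁺ (positive p a∈σ) (bounded p a∈σ))))
    (unique p)

  ∈-permutations⁻ : ∀ {n σ} → σ ∈ permutations n → IsPerm n σ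
  ∈-permutations⁻ {n} σ∈ with ∈-filter⁻ (unique? _≟_) {xs = words (interval n) n} σ∈
  ... | σ∈words , σ! = let |σ|≡n , σ⊆ = ∈-words⁻ n σ∈words in record
    { length≡ = |σ|≡n ; unique = σ! ; bounds = ∈-interval⁻ ∘ σ⊆ }

  -- By definition `red w` maps `suc ∘ rank w` over `w`.
  rank : Word → ℕ → ℕ
  rank w a = length (filter (_<? a) w)

  rank-∷-< : ∀ {x a} w → x < a → rank (x ∷ w) a ≡ suc (rank w a)
  rank-∷-< w x<a = cong length (filter-accept (_<? _) x<a)

  rank-∷-≥ : ∀ {x a} w → a ≤ x → rank (x ∷ w) a ≡ rank w a
  rank-∷-≥ w a≤x = cong length (filter-reject (_<? _) (≤⇒≯ a≤x))

  rank-++ : ∀ u v a → rank (u ++ v) a ≡ rank u a + rank v a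
  rank-++ u v a = trans (cong length (filter-++ (_<? a) u v)) (length-++ (filter (_<? a) u))

  rank-all : ∀ {a} w → (∀ {x} → x ∈ w → x < a) → rank w a ≡ length w
  rank-all w w<a = cong length (filter-all (_<? _) (All.tabulate w<a))

  rank-mono : ∀ {a b} w → a ≤ b → rank w a ≤ rank w b
  rank-mono []      a≤b = z≤n
  rank-mono {a} {b} (x ∷ w) a≤b with x <? a
  ... | yes x<a rewrite rank-∷-< w x<a | rank-∷-< w (<-≤-trans x<a a≤b) = s≤s (rank-mono w a≤b)
  ... | no  x≮a rewrite rank-∷-≥ w (≮⇒≥ x≮a) with x <? b
  ...   | yes x<b rewrite rank-∷-< w x<b = m≤n⇒m≤1+n (rank-mono w a≤b)
  ...   | no  x≮b rewrite rank-∷-≥ w (≮⇒≥ x≮b) = rank-mono w a≤b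

  -- This reads the order of letters off a reduction; it is the contrapositive of monotonicity.
  rank-reflects-< : ∀ {a b} w → rank w a < rank w b → a < b
  rank-reflects-< w r<r = ≰⇒> (λ b≤a → <⇒≱ r<r (rank-mono w b≤a))

  rank-shift : ∀ k w a → rank (map (k +_) w) (k + a) ≡ rank w a
  rank-shift k []      a = refl
  rank-shift k (x ∷ w) a with x <? a
  ... | yes x<a = trans (rank-∷-< (map (k +_) w) (+-monoʳ-< k x<a)) (trans (cong suc (rank-shift k w a)) (sym (rank-∷-< w x<a)))
  ... | no  x≮a = trans (rank-∷-≥ (map (k +_) w) (+-monoʳ-≤ k (≮⇒≥ x≮a))) (trans (rank-shift k w a) (sym (rank-∷-≥ w (≮⇒≥ x≮a))))

  length-red : ∀ w → length (red w) ≡ length w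
  length-red w = length-map _ w

  red-shift : ∀ k w → red (map (k +_) w) ≡ red w
  red-shift k w = trans (sym (map-∘ w)) (map-cong-local (All.tabulate (λ {a} _ → cong suc (rank-shift k w a))))

  -- A permutation is its own reduction: its letters below a + 1 are exactly 1, ..., a, and
  -- pigeonhole in both directions counts them.
  rank-IsPerm : ∀ {n σ a} → IsPerm n σ → a ∈ σ → suc (rank σ a) ≡ a
  rank-IsPerm {n} {σ} {zero}  p a∈σ = contradiction (positive p a∈σ) λ ()
  rank-IsPerm {n} {σ} {suc a} p a∈σ = cong suc (≤-antisym
    (≤-trans (Unique-⊆⇒length≤ (Uniqueₚ.filter⁺ (_<? suc a) (unique p)) below) (≤-reflexive (length-interval a)))
    (≤-trans (≤-reflexive (sym (length-interval a))) (Unique-⊆⇒length≤ (interval-unique a) above)))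
    where
    below : ∀ {b} → b ∈ filter (_<? suc a) σ → b ∈ interval a
    below b∈ = let b∈σ , b<1+a = ∈-filter⁻ (_<? suc a) b∈ in ∈-interval⁺ (positive p b∈σ) (≤-pred b<1+a)
    above : ∀ {b} → b ∈ interval a → b ∈ filter (_<? suc a) σ
    above b∈ = let 0<b , b≤a = ∈-interval⁻ b∈ in
      ∈-filter⁺ (_<? suc a) (IsPerm-complete p 0<b (≤-trans b≤a (<⇒≤ (bounded p a∈σ)))) (s≤s b≤a)

  132-pattern : Word
  132-pattern = 1 ∷ 3 ∷ 2 ∷ []

  -- The pattern in terms of comparisons of letters; ranks enter only in the passage to and from
  -- `Avoids`.
  Avoids132 : Word → Set
  Avoids132 σ = ∀ {a c b} → a ∷ c ∷ b ∷ [] ⊆ σ → a < b → b < c → ⊥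

  red-132⁺ : ∀ {a c b} → a < b → b < c → red (a ∷ c ∷ b ∷ []) ≡ 132-pattern
  red-132⁺ {a} {c} {b} a<b b<c = cong₂ (λ i w → suc i ∷ w) ra (cong₂ (λ i j → suc i ∷ suc j ∷ []) rc rb)
    where
    w = a ∷ c ∷ b ∷ []
    a<c = <-trans a<b b<c
    ra : rank w a ≡ 0
    ra = trans (rank-∷-≥ (c ∷ b ∷ []) (≤-refl {a})) (trans (rank-∷-≥ (b ∷ []) (<⇒≤ a<c)) (rank-∷-≥ [] (<⇒≤ a<b)))
    rc : rank w c ≡ 2
    rc = trans (rank-∷-< (c ∷ b ∷ []) a<c) (cong suc (trans (rank-∷-≥ (b ∷ []) (≤-refl {c})) (rank-∷-< [] b<c)))
    rb : rank w b ≡ 1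
    rb = trans (rank-∷-< (c ∷ b ∷ []) a<b) (cong suc (trans (rank-∷-≥ (b ∷ []) (<⇒≤ b<c)) (rank-∷-≥ [] (≤-refl {b}))))

  red-132⁻ : ∀ τ → red τ ≡ 132-pattern → ∃[ a ] ∃[ c ] ∃[ b ] τ ≡ a ∷ c ∷ b ∷ [] × a < b × b < c
  red-132⁻ []                  ()
  red-132⁻ (_ ∷ [])            eq with () ← cong length eq
  red-132⁻ (_ ∷ _ ∷ [])        eq with () ← cong length eq
  red-132⁻ (_ ∷ _ ∷ _ ∷ _ ∷ _) eq with () ← cong length eq
  red-132⁻ (a ∷ c ∷ b ∷ [])    eq = a , c , b , refl
      , rank-reflects-< w (subst₂ _<_ (sym ra) (sym rb) z<s)
      , rank-reflects-< w (subst₂ _<_ (sym rb) (sym rc) (s<s z<s))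
    where
    w = a ∷ c ∷ b ∷ []
    ra : rank w a ≡ 0
    ra = suc-injective (∷-injectiveˡ eq)
    rc : rank w c ≡ 2
    rc = suc-injective (∷-injectiveˡ (∷-injectiveʳ eq))
    rb : rank w b ≡ 1
    rb = suc-injective (∷-injectiveˡ (∷-injectiveʳ (∷-injectiveʳ eq)))

  Avoids⇒Avoids132 : ∀ {σ} → Avoids 132-pattern σ → Avoids132 σ
  Avoids⇒Avoids132 av τ⊆σ a<b b<c = av (_ , τ⊆σ , red-132⁺ a<b b<c)

  Avoids132⇒Avoids : ∀ {σ} → Avoids132 σ → Avoids 132-pattern σ
  Avoids132⇒Avoids av (τ , τ⊆σ , eq) with red-132⁻ τ eq
  ... | _ , _ , _ , refl , a<b , b<c = av τ⊆σ a<b b<c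

  Avoids132-⊆ : ∀ {τ σ} → τ ⊆ σ → Avoids132 σ → Avoids132 τ
  Avoids132-⊆ τ⊆σ av p = av (⊆-trans p τ⊆σ)

  ⊆-map⁻ : ∀ {f : ℕ → ℕ} {τ} σ → τ ⊆ map f σ → ∃[ τ′ ] τ ≡ map f τ′ × τ′ ⊆ σ
  ⊆-map⁻ []      []         = [] , refl , []
  ⊆-map⁻ (a ∷ σ) (skip _ p)   = let τ′ , eq , p′ = ⊆-map⁻ σ p in τ′ , eq , skip a p′
  ⊆-map⁻ (a ∷ σ) (refl ∷ p) = let τ′ , eq , p′ = ⊆-map⁻ σ p in a ∷ τ′ , cong (_ ∷_) eq , refl ∷ p′

  ⊆-++⁻ : ∀ {τ : Word} u {v} → τ ⊆ u ++ v → ∃₂ λ τ₁ τ₂ → τ ≡ τ₁ ++ τ₂ × τ₁ ⊆ u × τ₂ ⊆ v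
  ⊆-++⁻ []      p          = [] , _ , refl , [] , p
  ⊆-++⁻ (a ∷ u) (skip _ p)   = let τ₁ , τ₂ , eq , p₁ , p₂ = ⊆-++⁻ u p in τ₁ , τ₂ , eq , skip a p₁ , p₂
  ⊆-++⁻ (a ∷ u) (refl ∷ p) = let τ₁ , τ₂ , eq , p₁ , p₂ = ⊆-++⁻ u p in a ∷ τ₁ , τ₂ , cong (a ∷_) eq , refl ∷ p₁ , p₂

  Avoids132-shift⁺ : ∀ k {σ} → Avoids132 σ → Avoids132 (map (k +_) σ)
  Avoids132-shift⁺ k {σ} av p a<b b<c with ⊆-map⁻ σ p
  ... | _ ∷ _ ∷ _ ∷ [] , refl , p′ = av p′ (+-cancelˡ-< k _ _ a<b) (+-cancelˡ-< k _ _ b<c)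

  Avoids132-shift⁻ : ∀ k {σ} → Avoids132 (map (k +_) σ) → Avoids132 σ
  Avoids132-shift⁻ k av p a<b b<c = av (Sublist.map⁺ (k +_) p) (+-monoʳ-< k a<b) (+-monoʳ-< k b<c)

  _≫_ : Word → Word → Set
  u ≫ v = ∀ {a b} → a ∈ u → b ∈ v → b < a

  -- A 132 begins with its smallest letter, so it cannot begin in the upper block `u` and end in the
  -- lower block `v`; the cases are the number of its letters in `u`.
  Avoids132-++ : ∀ {u v} → Avoids132 u → Avoids132 v → u ≫ v → Avoids132 (u ++ v)
  Avoids132-++ {u} avᵤ avᵥ u≫v p a<b b<c with ⊆-++⁻ u p
  ... | []             , _ , refl , p₁ , p₂ = avᵥ p₂ a<b b<c
  ... | _ ∷ []         , _ , refl , p₁ , p₂ = <-asym a<b (u≫v (to∈ p₁) (⊆-lookup p₂ (there (here refl))))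
  ... | _ ∷ _ ∷ []     , _ , refl , p₁ , p₂ = <-asym a<b (u≫v (⊆-lookup p₁ (here refl)) (⊆-lookup p₂ (here refl)))
  ... | _ ∷ _ ∷ _ ∷ [] , [] , refl , p₁ , p₂ = avᵤ p₁ a<b b<c

  record Av (n : ℕ) (σ : Word) : Set where
    field
      isPerm : IsPerm n σ
      avoids : Avoids132 σ
    open IsPerm isPerm public

  open Av using (isPerm; avoids)

  ∈-𝒮⁺ : ∀ n {σ} → Av n σ → σ ∈ 𝒮 n 132-pattern
  ∈-𝒮⁺ n σ-av = ∈-filter⁺ (avoids? 132-pattern) (∈-permutations⁺ (isPerm σ-av)) (Avoids132⇒Avoids (avoids σ-av))

  ∈-𝒮⁻ : ∀ n {σ} → σ ∈ 𝒮 n 132-pattern → Av n σ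
  ∈-𝒮⁻ n σ∈ with ∈-filter⁻ (avoids? 132-pattern) {xs = permutations n} σ∈
  ... | σ∈perms , av = record { isPerm = ∈-permutations⁻ σ∈perms ; avoids = Avoids⇒Avoids132 av }

  𝒮-unique : ∀ n → Unique (𝒮 n 132-pattern)
  𝒮-unique n = Uniqueₚ.filter⁺ (avoids? 132-pattern)
    (Uniqueₚ.filter⁺ (unique? _≟_) (words-unique n (interval-unique n)))

  -- Skew sums

  infixr 5 _⊖_
  -- The shift is the length of `Q`, which is its largest letter when `Q` is a nonempty permutation.
  _⊖_ : Word → Word → Word
  P ⊖ Q = map (length Q +_) P ++ Q

  shift-≫ : ∀ {q P Q} → (∀ {a} → a ∈ P → 0 < a) → (∀ {b} → b ∈ Q → b ≤ q) → map (q +_) P ≫ Q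
  shift-≫ {q} 0<P Q≤q a∈ b∈Q with ∈-map⁻ (q +_) a∈
  ... | _ , a∈P , refl = ≤-<-trans (Q≤q b∈Q) (m<m+n q (0<P a∈P))

  ⊖-Av : ∀ {p q P Q} → Av p P → Av q Q → Av (p + q) (P ⊖ Q)
  ⊖-Av {p} {q} {P} {Q} avP avQ with Av.length≡ avQ
  ... | refl = record
    { isPerm = record
      { length≡ = trans (length-++ (map (q +_) P)) (cong (_+ q) (trans (length-map (q +_) P) (Av.length≡ avP)))
      ; unique  = Uniqueₚ.++⁺ (Uniqueₚ.map⁺ (+-cancelˡ-≡ q _ _) (Av.unique avP)) (Av.unique avQ)
          (λ (a∈ , a∈Q) → <-irrefl refl (≫Q a∈ a∈Q))
      ; bounds  = bounds′
      }
    ; avoids = Avoids132-++ (Avoids132-shift⁺ q (avoids avP)) (avoids avQ) ≫Q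
    }
    where
    ≫Q : map (q +_) P ≫ Q
    ≫Q = shift-≫ (Av.positive avP) (Av.bounded avQ)
    bounds′ : ∀ {a} → a ∈ P ⊖ Q → 0 < a × a ≤ p + q
    bounds′ a∈ with ∈-++⁻ (map (q +_) P) a∈
    ... | inj₂ a∈Q = Av.positive avQ a∈Q , ≤-trans (Av.bounded avQ a∈Q) (m≤n+m q p)
    ... | inj₁ a∈′ with ∈-map⁻ (q +_) a∈′
    ...   | b , b∈P , refl = ≤-trans (Av.positive avP b∈P) (m≤n+m b q)
                           , subst (q + b ≤_) (+-comm q p) (+-monoʳ-≤ q (Av.bounded avP b∈P))

  -- The letters of Q are the smallest ones, and a permutation has no gaps.
  ⊖-Av⁻ : ∀ {n P Q} → Av n (P ++ Q) → P ≫ Q →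
    Av (length Q) Q × ∃[ P′ ] Av (length P′) P′ × P ≡ map (length Q +_) P′
  ⊖-Av⁻ {n} {P} {Q} av P≫Q = avQ , map (_∸ q) P , avP′ , P≡
    where
    q p : ℕ
    q = length Q
    p = length P
    |P++Q| : p + q ≡ n
    |P++Q| = trans (sym (length-++ P)) (Av.length≡ av)

    Q! : Unique Q
    Q! = Unique-⊆ (Sublist.++⁺ˡ P ⊆-refl) (Av.unique av)

    -- All letters of `P` exceed `b`, so 1, ..., b all lie in `Q`, which therefore has at least `b`
    -- letters.
    Q-bounded : ∀ {b} → b ∈ Q → b ≤ q
    Q-bounded {b} b∈Q = ≤-trans (≤-reflexive (sym (length-interval b))) (Unique-⊆⇒length≤ (interval-unique b) incl)
      where
      incl : ∀ {c} → c ∈ interval b → c ∈ Q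
      incl {c} c∈ with ∈-interval⁻ c∈
      ... | 0<c , c≤b with ∈-++⁻ P (IsPerm-complete (isPerm av) 0<c (≤-trans c≤b (Av.bounded av (∈-++⁺ʳ P b∈Q))))
      ...   | inj₂ c∈Q = c∈Q
      ...   | inj₁ c∈P = contradiction c≤b (<⇒≱ (P≫Q c∈P b∈Q))

    q<P : ∀ {a} → a ∈ P → q < a
    q<P {zero}  a∈P = contradiction (Av.positive av (∈-++⁺ˡ a∈P)) λ ()
    q<P {suc a} a∈P = s≤s (≤-trans (Unique-⊆⇒length≤ Q! incl) (≤-reflexive (length-interval a)))
      where
      incl : ∀ {c} → c ∈ Q → c ∈ interval a
      incl c∈Q with P≫Q a∈P c∈Q
      ... | s≤s c≤a = ∈-interval⁺ (Av.positive av (∈-++⁺ʳ P c∈Q)) c≤a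

    avQ : Av q Q
    avQ = record
      { isPerm = record
        { length≡ = refl ; unique = Q!
        ; bounds = λ b∈Q → Av.positive av (∈-++⁺ʳ P b∈Q) , Q-bounded b∈Q }
      ; avoids = Avoids132-⊆ (Sublist.++⁺ˡ P ⊆-refl) (avoids av)
      }

    P≡ : P ≡ map (q +_) (map (_∸ q) P)
    P≡ = sym (trans (sym (map-∘ P)) (map-id-local (All.tabulate (λ a∈P → m+[n∸m]≡n (<⇒≤ (q<P a∈P))))))

    P⊆ : P ⊆ P ++ Q
    P⊆ = Sublist.++⁺ʳ Q ⊆-refl

    bounds′ : ∀ {a} → a ∈ map (_∸ q) P → 0 < a × a ≤ length (map (_∸ q) P)
    bounds′ a∈ with ∈-map⁻ (_∸ q) a∈
    ... | a , a∈P , refl = m<n⇒0<n∸m (q<P a∈P) , ≤-trans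
      (∸-monoˡ-≤ q (subst (a ≤_) (sym |P++Q|) (Av.bounded av (∈-++⁺ˡ a∈P))))
      (≤-reflexive (trans (m+n∸n≡m p q) (sym (length-map (_∸ q) P))))

    avP′ : Av (length (map (_∸ q) P)) (map (_∸ q) P)
    avP′ = record
      { isPerm = record
        { length≡ = refl
        ; unique  = Uniqueₚ.map⁻ (subst Unique P≡ (Unique-⊆ P⊆ (Av.unique av)))
        ; bounds  = bounds′
        }
      ; avoids = Avoids132-shift⁻ q (subst Avoids132 P≡ (Avoids132-⊆ P⊆ (avoids av)))
      }

  -- A letter of u below a letter of v would form a 132 together with c.
  Avoids132-≫ : ∀ {u c v} → Unique (u ++ c ∷ v) → Avoids132 (u ++ c ∷ v) →
    (∀ {b} → b ∈ v → b < c) → (u ∷ʳ c) ≫ v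
  Avoids132-≫ {u} {c} {v} σ! av v<c a∈ b∈v with ∈-++⁻ u a∈
  ... | inj₂ (here refl) = v<c b∈v
  ... | inj₁ a∈u = ≤∧≢⇒< (≮⇒≥ λ a<b → av (Sublist.++⁺ (from∈ a∈u) (refl ∷ from∈ b∈v)) a<b (v<c b∈v))
    (λ b≡a → Unique-++⇒≢ u σ! a∈u (there b∈v) (sym b≡a))

  Av-∷ʳ⁺ : ∀ {k L} → Av k L → Av (suc k) (L ∷ʳ suc k)
  Av-∷ʳ⁺ {k} {L} av = record
    { isPerm = record
      { length≡ = trans (length-∷ʳ L (suc k)) (cong suc (Av.length≡ av))
      ; unique  = Uniqueₚ.++⁺ (Av.unique av) ([] ∷ []) λ { (a∈L , here refl) → 1+n≰n (Av.bounded av a∈L) }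
      ; bounds  = bounds′
      }
    ; avoids = avoids′
    }
    where
    bounds′ : ∀ {a} → a ∈ L ∷ʳ suc k → 0 < a × a ≤ suc k
    bounds′ a∈ with ∈-++⁻ L a∈
    ... | inj₁ a∈L = Av.positive av a∈L , m≤n⇒m≤1+n (Av.bounded av a∈L)
    ... | inj₂ (here refl) = z<s , ≤-refl
    avoids′ : Avoids132 (L ∷ʳ suc k)
    avoids′ p a<b b<c with ⊆-++⁻ L p
    ... | _ ∷ _ ∷ _ ∷ [] , [] , refl , p₁ , _ = avoids av p₁ a<b b<c
    -- The appended letter would have to play the 2, yet it is the maximum.
    ... | _ ∷ _ ∷ [] , _ ∷ [] , refl , p₁ , refl ∷ [] =
      <⇒≱ b<c (m≤n⇒m≤1+n (Av.bounded av (⊆-lookup p₁ (there (here refl)))))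
    ... | _ ∷ [] , _ , refl , _ , skip _ ()
    ... | _ ∷ [] , _ , refl , _ , _ ∷ ()
    ... | [] , _ , refl , _ , skip _ ()
    ... | [] , _ , refl , _ , _ ∷ ()

  Av-∷ʳ⁻ : ∀ {k L} → Av (suc k) (L ∷ʳ suc k) → Av k L
  Av-∷ʳ⁻ {k} {L} av = record
    { isPerm = record
      { length≡ = suc-injective (trans (sym (length-∷ʳ L (suc k))) (Av.length≡ av))
      ; unique  = Unique-⊆ L⊆ (Av.unique av)
      ; bounds  = λ a∈L → Av.positive av (∈-++⁺ˡ a∈L)
          , ≤-pred (≤∧≢⇒< (Av.bounded av (∈-++⁺ˡ a∈L)) (Unique-++⇒≢ L (Av.unique av) a∈L (here refl)))
      }
    ; avoids = Avoids132-⊆ L⊆ (avoids av)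
    }
    where
    L⊆ : L ⊆ L ∷ʳ suc k
    L⊆ = Sublist.++⁺ʳ _ ⊆-refl

  -- Cutting a 132-avoiding permutation after its maximum

  glue : Word × Word → Word
  glue (L , R) = (L ∷ʳ suc (length L)) ⊖ R

  glue-Av : ∀ {k l L R} → Av k L → Av l R → Av (suc (k + l)) (glue (L , R))
  glue-Av avL avR with Av.length≡ avL
  ... | refl = ⊖-Av (Av-∷ʳ⁺ avL) avR

  glue-Av⁻ : ∀ {n σ} → Av (suc n) σ →
    ∃₂ λ L R → σ ≡ glue (L , R) × Av (length L) L × Av (length R) R × length L + length R ≡ n
  glue-Av⁻ {n} {σ} av with ∈-∃++ (IsPerm-complete (isPerm av) (z<s {n}) ≤-refl)
  ... | u , v , refl = decompose (⊖-Av⁻ (subst (Av (suc n)) (sym (∷ʳ-++ u (suc n) v)) av) u≫v)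
    where
    v<1+n : ∀ {b} → b ∈ v → b < suc n
    v<1+n b∈v = ≤∧≢⇒< (Av.bounded av (∈-++⁺ʳ u (there b∈v)))
      (λ b≡ → Unique-++⇒≢ (u ∷ʳ suc n) (subst Unique (sym (∷ʳ-++ u (suc n) v)) (Av.unique av))
                (∈-++⁺ʳ u (here refl)) b∈v (sym b≡))
    u≫v : (u ∷ʳ suc n) ≫ v
    u≫v = Avoids132-≫ (Av.unique av) (avoids av) v<1+n
    decompose : Av (length v) v × ∃[ P ] Av (length P) P × u ∷ʳ suc n ≡ map (length v +_) P →
      ∃₂ λ L R → u ++ suc n ∷ v ≡ glue (L , R) × Av (length L) L × Av (length R) R × length L + length R ≡ n
    decompose (avR , P , avP , eq) with initLast P
    ... | [] = contradiction (trans (sym (length-∷ʳ u (suc n))) (cong length eq)) λ ()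
    ... | L ∷ʳ′ l with ∷ʳ-injective u (map (length v +_) L) (trans eq (map-++ (length v +_) L [ l ]))
    ...   | _ , 1+n≡ = L , v , glued , Av-∷ʳ⁻ avP′ , avR , suc-injective lengths
      where
      lengths : suc (length L + length v) ≡ suc n
      lengths = trans (cong (_+ length v) (sym (length-∷ʳ L l)))
        (trans (cong (_+ length v) (sym (trans (cong length eq) (length-map (length v +_) (L ∷ʳ l)))))
        (trans (sym (length-++ (u ∷ʳ suc n))) (trans (cong length (∷ʳ-++ u (suc n) v)) (Av.length≡ av))))
      -- Shifted by `length v`, the letter `l` is n + 1, which is also the total length; so `l` is
      -- the length, and thus the maximum, of its own block.
      l≡ : l ≡ suc (length L)
      l≡ = +-cancelˡ-≡ (length v) _ _ (trans (sym 1+n≡) (trans (sym lengths) (+-comm (suc (length L)) (length v))))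
      avP′ : Av (suc (length L)) (L ∷ʳ suc (length L))
      avP′ = subst (λ a → Av (suc (length L)) (L ∷ʳ a)) l≡ (subst (λ k → Av k (L ∷ʳ l)) (length-∷ʳ L l) avP)
      glued : u ++ suc n ∷ v ≡ glue (L , v)
      glued = trans (sym (∷ʳ-++ u (suc n) v)) (cong (_++ v) (trans eq (cong (λ a → map (length v +_) (L ∷ʳ a)) l≡)))

  -- Both cuts are at the first occurrence of `a`, and the word determines where that is.
  ++-∷-cancel : ∀ {a : A} u {u′ v v′} → a ∉ u → a ∉ u′ → u ++ a ∷ v ≡ u′ ++ a ∷ v′ → u ≡ u′ × v ≡ v′
  ++-∷-cancel []      {[]}     a∉u a∉u′ eq = refl , ∷-injectiveʳ eq
  ++-∷-cancel []      {x ∷ u′} a∉u a∉u′ eq = contradiction (here (∷-injectiveˡ eq)) a∉u′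
  ++-∷-cancel (x ∷ u) {[]}     a∉u a∉u′ eq = contradiction (here (sym (∷-injectiveˡ eq))) a∉u
  ++-∷-cancel (x ∷ u) {y ∷ u′} a∉u a∉u′ eq with ∷-injective eq
  ... | refl , eq′ with ++-∷-cancel u (a∉u ∘ there) (a∉u′ ∘ there) eq′
  ...   | refl , v≡ = refl , v≡

  glue-unfold : ∀ L R → glue (L , R) ≡ map (length R +_) L ++ (length R + suc (length L)) ∷ R
  glue-unfold L R = trans (cong (_++ R) (map-++ (length R +_) L [ suc (length L) ])) (∷ʳ-++ (map (length R +_) L) _ R)

  -- Equal total lengths give both words the same top letter, which occurs in neither shifted
  -- prefix. Cutting there recovers `R`, and with it the shift to be undone on `L`.
  glue-injective : ∀ {k l k′ l′ L R L′ R′} → Av k L → Av l R → Av k′ L′ → Av l′ R′ → k + l ≡ k′ + l′ →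
    glue (L , R) ≡ glue (L′ , R′) → (L , R) ≡ (L′ , R′)
  glue-injective {L = L} {R} {L′} {R′} avL avR avL′ avR′ k+l≡ eq
    with refl ← Av.length≡ avL | refl ← Av.length≡ avR | refl ← Av.length≡ avL′ | refl ← Av.length≡ avR′
    with ++-∷-cancel (map (length R +_) L) (top∉ avL) (subst (_∉ map (length R′ +_) L′) (sym tops) (top∉ avL′))
      (trans (sym (glue-unfold L R)) (trans eq (trans (glue-unfold L′ R′) (cong (λ a → map (length R′ +_) L′ ++ a ∷ R′) (sym tops)))))
    where
    top∉ : ∀ {h L} → Av (length L) L → h + suc (length L) ∉ map (h +_) L
    top∉ {h} avL a∈ with ∈-map⁻ (h +_) a∈
    ... | b , b∈L , h+≡ = 1+n≰n (subst (_≤ _) (sym (+-cancelˡ-≡ h _ _ h+≡)) (Av.bounded avL b∈L))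
    tops : length R + suc (length L) ≡ length R′ + suc (length L′)
    tops = trans (+-suc (length R) (length L)) (trans (cong suc (trans (+-comm (length R) _) (trans k+l≡ (+-comm (length L′) _))))
      (sym (+-suc (length R′) (length L′))))
  ... | L≡ , refl = cong (_, R) (map-injective (+-cancelˡ-≡ (length R) _ _) L≡)

-- Counting consecutive matches

module MatchCounting where

  open PatternAvoidance
  open import Data.Nat.Base using (_+_)
  open ℕₚ
  open ≡ using (refl; sym; trans)

  take-++-≤ : ∀ {m} (xs : List A) {ys} → m ≤ length xs → take m (xs ++ ys) ≡ take m xs
  take-++-≤ {m = zero}  xs    _         = refl
  take-++-≤ {m = suc _} (x ∷ xs) (s≤s m≤n) = cong (x ∷_) (take-++-≤ xs m≤n)

  take-++-≥ : ∀ {m} (xs : List A) {ys} → length xs ≤ m → take m (xs ++ ys) ≡ xs ++ take (m ∸ length xs) ys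
  take-++-≥ []       _         = refl
  take-++-≥ {m = suc _} (x ∷ xs) (s≤s n≤m) = cong (x ∷_) (take-++-≥ xs n≤m)

  drop-++ : ∀ (xs : List A) {ys} → drop (length xs) (xs ++ ys) ≡ ys
  drop-++ []       = refl
  drop-++ (x ∷ xs) = drop-++ xs

  ∈-take⁻ : ∀ n {xs : List A} {a} → a ∈ take n xs → a ∈ xs
  ∈-take⁻ (suc n) {_ ∷ _} (here eq)  = here eq
  ∈-take⁻ (suc n) {_ ∷ _} (there a∈) = there (∈-take⁻ n a∈)

  -- The 0/1 indicator of a match, written as a filtered singleton because this is the term that
  -- `filter-++` splits off from `mch`.
  hit : Word → Word → ℕ
  hit γ w = length (filter (λ w → red w ≟ᵂ γ) [ w ])

  hit-yes : ∀ γ w → red w ≡ γ → hit γ w ≡ 1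
  hit-yes γ w eq = cong length (filter-accept (λ w → red w ≟ᵂ γ) {xs = []} eq)

  hit-no : ∀ γ w → red w ≢ γ → hit γ w ≡ 0
  hit-no γ w neq = cong length (filter-reject (λ w → red w ≟ᵂ γ) {xs = []} neq)

  hit-short : ∀ γ w → length w < length γ → hit γ w ≡ 0
  hit-short γ w |w|< = hit-no γ w (λ eq → <⇒≢ |w|< (trans (sym (length-red w)) (cong length eq)))

  hit-red : ∀ γ u v → red u ≡ red v → hit γ u ≡ hit γ v
  hit-red γ u v eq = by-cases (red v ≟ᵂ γ)
    where
    by-cases : Dec (red v ≡ γ) → hit γ u ≡ hit γ v
    by-cases (yes eq′) = trans (hit-yes γ u (trans eq eq′)) (sym (hit-yes γ v eq′))
    by-cases (no neq)  = trans (hit-no γ u (neq ∘ trans (sym eq))) (sym (hit-no γ v neq))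

  hit-take-short : ∀ γ m w → length w < length γ → hit γ (take m w) ≡ 0
  hit-take-short γ m w |w|< = hit-short γ (take m w)
    (≤-<-trans (≤-trans (≤-reflexive (length-take m w)) (m⊓n≤n m (length w))) |w|<)

  module _ (g : ℕ) (γ′ : Word) where

    private
      γ : Word
      γ = g ∷ γ′
      m : ℕ
      m = length γ

    -- A nonempty pattern is essential: the empty one would match the single empty window.
    mch-[] : mch γ [] ≡ 0
    mch-[] rewrite 0∸n≡0 (length γ′) = refl

    -- Near the end of the word `take m` returns a truncated window, too short to match, so one
    -- recursion covers all lengths.
    mch-∷ : ∀ a σ → mch γ (a ∷ σ) ≡ hit γ (take m (a ∷ σ)) + mch γ σ
    mch-∷ a σ with m ≤? suc (length σ)
    ... | yes (s≤s |γ′|≤) = begin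
      mch γ (a ∷ σ)
        ≡⟨ cong (λ k → length (filter P? (map (λ i → take m (drop i (a ∷ σ))) (upTo k)))) (+-∸-assoc 1 |γ′|≤) ⟩
      length (filter P? (take m (a ∷ σ) ∷ map (λ i → take m (drop i (a ∷ σ))) (applyUpTo suc k)))
        ≡⟨ cong (λ ws → length (filter P? (take m (a ∷ σ) ∷ ws))) (trans (map-applyUpTo suc _ k) (sym (map-applyUpTo id _ k))) ⟩
      length (filter P? ([ take m (a ∷ σ) ] ++ windows m σ))
        ≡⟨ cong length (filter-++ P? [ take m (a ∷ σ) ] (windows m σ)) ⟩
      length (filter P? [ take m (a ∷ σ) ] ++ filter P? (windows m σ))
        ≡⟨ length-++ (filter P? [ take m (a ∷ σ) ]) ⟩
      hit γ (take m (a ∷ σ)) + mch γ σ ∎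
      where
      open ≡-Reasoning
      P? = λ w → red w ≟ᵂ γ
      k = length σ ∸ length γ′
    ... | no m≰ = trans (cong (λ k → length (filter P? (map (λ i → take m (drop i (a ∷ σ))) (upTo k)))) none)
      (sym (cong₂ _+_ (hit-take-short γ m (a ∷ σ) (≰⇒> m≰))
                      (cong (λ k → length (filter P? (map (λ i → take m (drop i σ)) (upTo k)))) none′)))
      where
      P? = λ w → red w ≟ᵂ γ
      none : suc (length σ) ∸ length γ′ ≡ 0
      none = m≤n⇒m∸n≡0 (≤-pred (≰⇒> m≰))
      none′ : length σ ∸ length γ′ ≡ 0
      none′ = m≤n⇒m∸n≡0 (≤-trans (n≤1+n _) (≤-pred (≰⇒> m≰)))

    mch-short : ∀ σ → length σ < m → mch γ σ ≡ 0
    mch-short []      _    = mch-[]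
    mch-short (a ∷ σ) |σ|< = trans (mch-∷ a σ)
      (cong₂ _+_ (hit-take-short γ m (a ∷ σ) |σ|<) (mch-short σ (≤-trans (n≤1+n _) |σ|<)))

    mch-shift : ∀ k σ → mch γ (map (k +_) σ) ≡ mch γ σ
    mch-shift k []      = refl
    mch-shift k (a ∷ σ) = begin
      mch γ (map (k +_) (a ∷ σ))
        ≡⟨ mch-∷ (k + a) (map (k +_) σ) ⟩
      hit γ (take m (map (k +_) (a ∷ σ))) + mch γ (map (k +_) σ)
        ≡⟨ cong₂ _+_ (trans (cong (hit γ) (take-map m (a ∷ σ)))
                            (hit-red γ (map (k +_) w) w (red-shift k w)))
                     (mch-shift k σ) ⟩
      hit γ (take m (a ∷ σ)) + mch γ σ
        ≡⟨ mch-∷ a σ ⟨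
      mch γ (a ∷ σ) ∎
      where
      open ≡-Reasoning
      w = take m (a ∷ σ)

    -- An appended letter lies in one window only, the last. If the word is shorter than γ, the
    -- subtraction yields 0 and the last window is the whole word, too short to match.
    mch-∷ʳ : ∀ w n → mch γ (w ∷ʳ n) ≡ mch γ w + hit γ (drop (suc (length w) ∸ m) (w ∷ʳ n))
    mch-∷ʳ [] n rewrite 0∸n≡0 (length γ′) =
      trans (mch-∷ n []) (trans (cong₂ _+_ (cong (λ u → hit γ (n ∷ u)) (take-[] (length γ′))) mch-[]) (+-identityʳ _))
    mch-∷ʳ (a ∷ w) n with m ≤? suc (length w)
    ... | yes m≤ = begin
      mch γ (a ∷ w ∷ʳ n)
        ≡⟨ mch-∷ a (w ∷ʳ n) ⟩
      hit γ (take m ((a ∷ w) ∷ʳ n)) + mch γ (w ∷ʳ n)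
        ≡⟨ cong₂ _+_ (cong (hit γ) (take-++-≤ (a ∷ w) m≤)) (mch-∷ʳ w n) ⟩
      hit γ (take m (a ∷ w)) + (mch γ w + hit γ (drop (suc (length w) ∸ m) (w ∷ʳ n)))
        ≡⟨ +-assoc (hit γ (take m (a ∷ w))) _ _ ⟨
      hit γ (take m (a ∷ w)) + mch γ w + hit γ (drop (suc (length w) ∸ m) (w ∷ʳ n))
        ≡⟨ cong₂ _+_ (sym (mch-∷ a w)) (cong (λ i → hit γ (drop i (a ∷ w ∷ʳ n))) (sym (+-∸-assoc 1 m≤))) ⟩
      mch γ (a ∷ w) + hit γ (drop (suc (suc (length w)) ∸ m) (a ∷ w ∷ʳ n)) ∎
      where open ≡-Reasoning
    ... | no m≰ = begin
      mch γ (a ∷ w ∷ʳ n)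
        ≡⟨ mch-∷ a (w ∷ʳ n) ⟩
      hit γ (take m (a ∷ w ∷ʳ n)) + mch γ (w ∷ʳ n)
        ≡⟨ cong₂ _+_ (cong (hit γ) (take-all m (a ∷ w ∷ʳ n) (≤-trans (≤-reflexive (cong suc (length-∷ʳ w n))) |w|+2≤m)))
                     (mch-short (w ∷ʳ n) (≤-trans (≤-reflexive (cong suc (length-∷ʳ w n))) |w|+2≤m)) ⟩
      hit γ (a ∷ w ∷ʳ n) + 0
        ≡⟨ +-comm (hit γ (a ∷ w ∷ʳ n)) 0 ⟩
      hit γ (a ∷ w ∷ʳ n)
        ≡⟨ cong₂ _+_ (sym (mch-short (a ∷ w) |w|+2≤m))
                     (cong (λ i → hit γ (drop i (a ∷ w ∷ʳ n))) (sym (m≤n⇒m∸n≡0 |w|+2≤m))) ⟩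
      mch γ (a ∷ w) + hit γ (drop (suc (suc (length w)) ∸ m) (a ∷ w ∷ʳ n)) ∎
      where
      open ≡-Reasoning
      |w|+2≤m = ≰⇒> m≰

  -- Matches of γ = (d+1) δ (d+2)

  module Matches {d δ} (δ-perm : IsPerm d δ) where

    γ : Word
    γ = suc d ∷ δ ∷ʳ suc (suc d)

    |γ| : length γ ≡ suc (suc d)
    |γ| = cong suc (trans (length-∷ʳ δ _) (cong suc (IsPerm.length≡ δ-perm)))

    -- The letters `c` and `e` exceed those of δ′ and leave their ranks unchanged, and δ′ is its own
    -- reduction.
    red-match : ∀ {δ′ c e} → IsPerm d δ′ → d < c → c < e → red (c ∷ δ′ ∷ʳ e) ≡ suc d ∷ δ′ ∷ʳ suc (suc d)
    red-match {δ′} {c} {e} p d<c c<e = cong₂ _∷_ (cong suc rank-c)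
      (trans (map-++ (suc ∘ rank w) δ′ [ e ])
        (cong₂ _++_ (map-id-local (All.tabulate rank-δ′)) (cong (λ r → [ suc r ]) rank-e)))
      where
      w = c ∷ δ′ ∷ʳ e
      δ′<c : ∀ {a} → a ∈ δ′ → a < c
      δ′<c a∈ = ≤-<-trans (IsPerm.bounded p a∈) d<c
      rank-δ′ : ∀ {a} → a ∈ δ′ → suc (rank w a) ≡ a
      rank-δ′ {a} a∈ = trans (cong suc (trans (rank-∷-≥ (δ′ ∷ʳ e) (<⇒≤ (δ′<c a∈))) (trans (rank-++ δ′ [ e ] a)
        (trans (cong (rank δ′ a +_) (rank-∷-≥ [] (<⇒≤ (<-trans (δ′<c a∈) c<e)))) (+-identityʳ _)))))
        (rank-IsPerm p a∈)
      rank-c : rank w c ≡ d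
      rank-c = trans (rank-∷-≥ (δ′ ∷ʳ e) (≤-refl {c})) (trans (rank-++ δ′ [ e ] c)
        (trans (cong₂ _+_ (rank-all δ′ δ′<c) (rank-∷-≥ [] (<⇒≤ c<e))) (trans (+-identityʳ _) (IsPerm.length≡ p))))
      rank-e : rank w e ≡ suc d
      rank-e = trans (rank-∷-< (δ′ ∷ʳ e) c<e) (cong suc (trans (rank-++ δ′ [ e ] e)
        (trans (cong₂ _+_ (rank-all δ′ (λ a∈ → <-trans (δ′<c a∈) c<e)) (rank-∷-≥ [] (≤-refl {e})))
          (trans (+-identityʳ _) (IsPerm.length≡ p)))))

    match-shape : ∀ w → red w ≡ γ → ∃[ c ] ∃[ δ′ ] ∃[ e ] w ≡ c ∷ δ′ ∷ʳ e × (∀ {a} → a ∈ δ′ → a < c) × c < e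
    match-shape []      eq with () ← cong length eq
    match-shape (c ∷ w) eq with initLast w
    ... | []         = contradiction (trans (cong length eq) |γ|) λ ()
    ... | δ′ ∷ʳ′ e = c , δ′ , e , refl , below , rank-reflects-< v (subst₂ _<_ (sym rank-c) (sym rank-e) ≤-refl)
      where
      v = c ∷ δ′ ∷ʳ e
      rank-c : rank v c ≡ d
      rank-c = suc-injective (∷-injectiveˡ eq)
      parts : map (suc ∘ rank v) δ′ ≡ δ × suc (rank v e) ≡ suc (suc d)
      parts = ∷ʳ-injective _ δ (trans (sym (map-++ (suc ∘ rank v) δ′ [ e ])) (∷-injectiveʳ eq))
      rank-e : rank v e ≡ suc d
      rank-e = suc-injective (proj₂ parts)
      below : ∀ {a} → a ∈ δ′ → a < c
      below {a} a∈ = rank-reflects-< v (subst (rank v a <_) (sym rank-c)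
        (IsPerm.bounded δ-perm (subst (suc (rank v a) ∈_) (proj₁ parts) (∈-map⁺ (suc ∘ rank v) a∈))))

    -- The last letter of a match exceeds all others, so nothing smaller can follow `n`.
    match-max-last : ∀ u {n v} → (∀ {b} → b ∈ v → b < n) → red (u ++ n ∷ v) ≡ γ → v ≡ []
    match-max-last u {n} {v} v<n eq with initLast v
    ... | []        = refl
    ... | v′ ∷ʳ′ b with match-shape _ eq
    ...   | c , δ′ , e , w≡ , δ′<c , c<e
      with ∷ʳ-injective (u ++ n ∷ v′) (c ∷ δ′) (trans (++-assoc u (n ∷ v′) [ b ]) w≡)
    ...     | u≡ , refl = contradiction (n<b (subst (n ∈_) u≡ (∈-++⁺ʳ u (here refl)))) (<-asym (v<n (∈-++⁺ʳ v′ (here refl))))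
      where
      n<b : n ∈ c ∷ δ′ → n < b
      n<b (here refl) = c<e
      n<b (there n∈)  = <-trans (δ′<c n∈) c<e

    private
      m : ℕ
      m = length γ

      mch-∷γ  = mch-∷ (suc d) (δ ∷ʳ suc (suc d))
      mch-[]γ = mch-[] (suc d) (δ ∷ʳ suc (suc d))

    -- A window that fits into `u ∷ʳ n` is unaffected by `v`. A longer one either has a smaller
    -- letter after `n` or is truncated, and in both cases neither side counts a match.
    hit-crossing : ∀ u {n v} → (∀ {b} → b ∈ v → b < n) → hit γ (take m (u ++ n ∷ v)) ≡ hit γ (take m (u ∷ʳ n))
    hit-crossing u {n} {v} v<n with m ≤? length (u ∷ʳ n)
    ... | yes m≤ = cong (hit γ) (trans (cong (take m) (sym (∷ʳ-++ u n v))) (take-++-≤ (u ∷ʳ n) m≤))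
    ... | no  m≰ = trans (hit-no γ (take m (u ++ n ∷ v)) no-match) (sym (hit-take-short γ m (u ∷ʳ n) (≰⇒> m≰)))
      where
      k = m ∸ length (u ∷ʳ n)
      truncated : take m (u ++ n ∷ v) ≡ u ++ n ∷ take k v
      truncated = trans (cong (take m) (sym (∷ʳ-++ u n v))) (trans (take-++-≥ (u ∷ʳ n) (≰⇒≥ m≰)) (∷ʳ-++ u n (take k v)))
      no-match : red (take m (u ++ n ∷ v)) ≢ γ
      no-match eq = m≰ (≤-reflexive (trans (sym (cong length eq′)) (trans (length-red (u ++ n ∷ take k v))
                          (cong (λ r → length (u ++ n ∷ r)) (match-max-last u (v<n ∘ ∈-take⁻ k) eq′)))))
        where
        eq′ : red (u ++ n ∷ take k v) ≡ γ
        eq′ = subst (λ w → red w ≡ γ) truncated eq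

    -- Only `n` has to exceed `v`, since a crossing window always contains `n`; this weaker
    -- hypothesis is preserved when letters of `u` are peeled off.
    mch-++-∷ : ∀ u {n v} → (∀ {b} → b ∈ v → b < n) → mch γ (u ++ n ∷ v) ≡ mch γ (u ∷ʳ n) + mch γ v
    mch-++-∷ [] {n} {v} v<n = trans (mch-∷γ n v) (cong (_+ mch γ v)
      (trans (hit-crossing [] v<n) (sym (trans (mch-∷γ n [])
        (trans (cong (hit γ (take m [ n ]) +_) (mch-[] (suc d) (δ ∷ʳ suc (suc d)))) (+-identityʳ _))))))
    mch-++-∷ (a ∷ u) {n} {v} v<n = begin
      mch γ (a ∷ u ++ n ∷ v)
        ≡⟨ mch-∷γ a (u ++ n ∷ v) ⟩
      hit γ (take m (a ∷ u ++ n ∷ v)) + mch γ (u ++ n ∷ v)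
        ≡⟨ cong₂ _+_ (hit-crossing (a ∷ u) v<n) (mch-++-∷ u v<n) ⟩
      hit γ (take m (a ∷ u ∷ʳ n)) + (mch γ (u ∷ʳ n) + mch γ v)
        ≡⟨ +-assoc (hit γ (take m (a ∷ u ∷ʳ n))) _ _ ⟨
      hit γ (take m (a ∷ u ∷ʳ n)) + mch γ (u ∷ʳ n) + mch γ v
        ≡⟨ cong (_+ mch γ v) (mch-∷γ a (u ∷ʳ n)) ⟨
      mch γ (a ∷ u ∷ʳ n) + mch γ v ∎
      where open ≡-Reasoning

    mch-⊖ : ∀ {p q P Q} → Av p P → Av q Q → mch γ (P ⊖ Q) ≡ mch γ P + mch γ Q
    mch-⊖ {P = P} {Q} avP avQ with initLast P
    ... | []      = cong (_+ mch γ Q) (sym mch-[]γ)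
    ... | u ∷ʳ′ a = begin
      mch γ (map (q +_) (u ∷ʳ a) ++ Q)
        ≡⟨ cong (mch γ) (trans (cong (_++ Q) (map-++ (q +_) u [ a ])) (∷ʳ-++ (map (q +_) u) (q + a) Q)) ⟩
      mch γ (map (q +_) u ++ (q + a) ∷ Q)
        ≡⟨ mch-++-∷ (map (q +_) u) (shift-≫ (Av.positive avP) Q≤q (∈-map⁺ (q +_) (∈-++⁺ʳ u (here refl)))) ⟩
      mch γ (map (q +_) u ∷ʳ (q + a)) + mch γ Q
        ≡⟨ cong (λ w → mch γ w + mch γ Q) (map-++ (q +_) u [ a ]) ⟨
      mch γ (map (q +_) (u ∷ʳ a)) + mch γ Q
        ≡⟨ cong (_+ mch γ Q) (mch-shift (suc d) (δ ∷ʳ suc (suc d)) q (u ∷ʳ a)) ⟩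
      mch γ (u ∷ʳ a) + mch γ Q ∎
      where
      open ≡-Reasoning
      q = length Q
      Q≤q : ∀ {b} → b ∈ Q → b ≤ q
      Q≤q b∈ = subst (_ ≤_) (sym (Av.length≡ avQ)) (Av.bounded avQ b∈)

    mch-glue : ∀ {k l L R} → Av k L → Av l R → mch γ (glue (L , R)) ≡ mch γ (L ∷ʳ suc (length L)) + mch γ R
    mch-glue avL avR with refl ← Av.length≡ avL = mch-⊖ (Av-∷ʳ⁺ avL) avR

    -- Appending a new maximum to L completes a match of γ.
    Ends : Word → Set
    Ends L = red (drop (suc (length L) ∸ m) (L ∷ʳ suc (length L))) ≡ γ

    mch-∷ʳ-max : ∀ L → mch γ (L ∷ʳ suc (length L)) ≡ mch γ L + hit γ (drop (suc (length L) ∸ m) (L ∷ʳ suc (length L)))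
    mch-∷ʳ-max L = mch-∷ʳ (suc d) (δ ∷ʳ suc (suc d)) L (suc (length L))

    Ends⁻ : ∀ {k L} → Av k L → Ends L → ∃[ L′ ] Av (length L′) L′ × 0 < length L′ × L ≡ L′ ⊖ δ
    Ends⁻ {k} {L} av eq with match-shape _ eq
    ... | c , δ′ , e , w≡ , δ′<c , c<e = decompose (⊖-Av⁻ (subst (Av k) L≡ av) u≫δ′)
      where
      s = suc (length L)
      u = take (s ∸ m) (L ∷ʳ s)
      whole : L ∷ʳ s ≡ (u ++ c ∷ δ′) ∷ʳ e
      whole = trans (sym (take++drop≡id (s ∸ m) (L ∷ʳ s))) (trans (cong (u ++_) w≡) (sym (++-assoc u (c ∷ δ′) [ e ])))
      L≡u : L ≡ u ++ c ∷ δ′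
      L≡u = proj₁ (∷ʳ-injective L (u ++ c ∷ δ′) whole)
      L≡ : L ≡ (u ∷ʳ c) ++ δ′
      L≡ = trans L≡u (sym (∷ʳ-++ u c δ′))
      u≫δ′ : (u ∷ʳ c) ≫ δ′
      u≫δ′ = Avoids132-≫ (subst Unique L≡u (Av.unique av)) (subst Avoids132 L≡u (Av.avoids av)) δ′<c
      eq′ : red (c ∷ δ′ ∷ʳ e) ≡ γ
      eq′ = subst (λ w → red w ≡ γ) w≡ eq
      |δ′| : length δ′ ≡ d
      |δ′| = suc-injective (suc-injective (trans (cong suc (sym (length-∷ʳ δ′ e)))
        (trans (sym (length-red (c ∷ δ′ ∷ʳ e))) (trans (cong length eq′) |γ|))))
      decompose : Av (length δ′) δ′ × ∃[ L′ ] Av (length L′) L′ × u ∷ʳ c ≡ map (length δ′ +_) L′ →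
        ∃[ L′ ] Av (length L′) L′ × 0 < length L′ × L ≡ L′ ⊖ δ
      -- Undoing the shift on `c` exhibits a letter of `L′`, so `L′` is nonempty; it also gives `c`
      -- > d.
      decompose (avδ′ , L′ , avL′ , uc≡) with ∈-map⁻ (length δ′ +_) (subst (c ∈_) uc≡ (∈-++⁺ʳ u (here refl)))
      ... | c′ , c′∈L′ , c≡ = L′ , avL′ , ∈-length c′∈L′
          , trans L≡ (trans (cong (_++ δ′) uc≡) (cong (L′ ⊖_) δ′≡δ))
        where
        d<c : d < c
        d<c = subst (d <_) (sym (trans c≡ (cong (_+ c′) |δ′|))) (m<m+n d (Av.positive avL′ c′∈L′))
        -- Now that δ′ is a permutation of 1, ..., d, the reduction of the match contains δ′ itself
        -- in the place of δ.
        δ′≡δ : δ′ ≡ δ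
        δ′≡δ = proj₁ (∷ʳ-injective δ′ δ (∷-injectiveʳ
          (trans (sym (red-match (subst (λ k → IsPerm k δ′) |δ′| (Av.isPerm avδ′)) d<c c<e)) eq′)))

    -- The last letter of the nonempty `L′` plays d+1 and the new maximum plays d+2; the skew sum
    -- puts δ between and below them.
    Ends⁺ : ∀ {k L′} → Av (suc k) L′ → Ends (L′ ⊖ δ)
    Ends⁺ {k} {L′} av with initLast L′
    ... | []       = contradiction (Av.length≡ av) λ ()
    ... | L″ ∷ʳ′ c = trans (cong red suffix) (red-match δ-perm d<q+c q+c<s)
      where
      q = length δ
      L = (L″ ∷ʳ c) ⊖ δ
      s = suc (length L)
      |L| : length L ≡ suc k + d
      |L| = trans (length-++ (map (q +_) (L″ ∷ʳ c)))
        (cong₂ _+_ (trans (length-map (q +_) (L″ ∷ʳ c)) (Av.length≡ av)) (IsPerm.length≡ δ-perm))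
      |L″| : length (map (q +_) L″) ≡ k
      |L″| = trans (length-map (q +_) L″) (suc-injective (trans (sym (length-∷ʳ L″ c)) (Av.length≡ av)))
      c∈ : c ∈ L″ ∷ʳ c
      c∈ = ∈-++⁺ʳ L″ (here refl)
      d<q+c : d < q + c
      d<q+c = subst (_< q + c) (IsPerm.length≡ δ-perm) (m<m+n q (Av.positive av c∈))
      q+c<s : q + c < s
      q+c<s = s≤s (≤-trans (+-mono-≤ (≤-reflexive (IsPerm.length≡ δ-perm)) (Av.bounded av c∈))
                           (≤-reflexive (trans (+-comm d (suc k)) (sym |L|))))
      whole : L ∷ʳ s ≡ map (q +_) L″ ++ (q + c) ∷ δ ∷ʳ s
      whole = trans (cong (λ w → (w ++ δ) ∷ʳ s) (map-++ (q +_) L″ [ c ]))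
        (trans (cong (_∷ʳ s) (∷ʳ-++ (map (q +_) L″) (q + c) δ)) (++-assoc (map (q +_) L″) ((q + c) ∷ δ) [ s ]))
      start : s ∸ m ≡ length (map (q +_) L″)
      start = trans (cong₂ _∸_ (cong suc (trans |L| (sym (+-suc k d)))) |γ|)
        (trans (cong (_∸ suc d) (+-suc k d)) (trans (m+n∸n≡m k d) (sym |L″|)))
      suffix : drop (s ∸ m) (L ∷ʳ s) ≡ (q + c) ∷ δ ∷ʳ s
      suffix = trans (cong₂ drop start whole) (drop-++ (map (q +_) L″))

    mch-⊖δ : ∀ {p P} → Av p P → Av d δ → mch γ (P ⊖ δ) ≡ mch γ P
    mch-⊖δ {P = P} avP avδ = trans (mch-⊖ avP avδ) (trans (cong (mch γ P +_)
      (mch-short (suc d) (δ ∷ʳ suc (suc d)) δ (s≤s (≤-trans (n≤1+n _) (≤-reflexive (sym (length-∷ʳ δ _)))))))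
      (+-identityʳ _))

-- Bijections as rearrangements of lists

open PatternAvoidance
open MatchCounting

-- Injectivity is asked on members only, because `glue-injective` assumes avoiding permutations of
-- equal total length.
Unique-map⁺ : ∀ {f : A → C} {xs} → (∀ {y z} → y ∈ xs → z ∈ xs → f y ≡ f z → y ≡ z) → Unique xs → Unique (map f xs)
Unique-map⁺ inj []         = []
Unique-map⁺ {f = f} inj (x∉ ∷ xs!) = All.tabulate fx∉ ∷ Unique-map⁺ (λ y∈ z∈ → inj (there y∈) (there z∈)) xs!
  where
  fx∉ : ∀ {y} → y ∈ map f _ → f _ ≢ y
  fx∉ y∈ fx≡y with ∈-map⁻ f y∈
  ... | z , z∈ , ≡.refl = All.lookup x∉ z∈ (inj (here ≡.refl) (there z∈) fx≡y)

Unique-concatMap⁺ : ∀ {f : A → List C} {xs} → (∀ {y z v} → y ∈ xs → z ∈ xs → v ∈ f y → v ∈ f z → y ≡ z) →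
  (∀ y → Unique (f y)) → Unique xs → Unique (concatMap f xs)
Unique-concatMap⁺ inj f! [] = []
Unique-concatMap⁺ {f = f} {xs = x ∷ xs} inj f! (x∉ ∷ xs!) = Uniqueₚ.++⁺ (f! x)
  (Unique-concatMap⁺ (λ y∈ z∈ → inj (there y∈) (there z∈)) f! xs!) disjoint
  where
  disjoint : ∀ {v} → ¬ (v ∈ f x × v ∈ concatMap f xs)
  disjoint (v∈fx , v∈) with find (∈-concatMap⁻ f {xs = xs} v∈)
  ... | y , y∈ , v∈fy = All.lookup x∉ y∈ (inj (here ≡.refl) (there y∈) v∈fx v∈fy)

-- This reduces a bijective proof to two inclusions; `∑-↭` then carries the sum across.
Unique-↭ : ∀ {xs ys : List A} → Unique xs → Unique ys → (∀ {v} → v ∈ xs → v ∈ ys) → (∀ {v} → v ∈ ys → v ∈ xs) → xs ↭ ys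
Unique-↭ xs! ys! to from = ∼bag⇒↭ (unique∧set⇒bag xs! ys! (mk⇔ to from))

𝒮₁₃₂ : ℕ → List Word
𝒮₁₃₂ n = 𝒮 n 132-pattern

-- Indexed like the convolution of series, so that a multiplicative weight summed over `splits n` is
-- coefficient n of a product.
splits : ℕ → List (Word × Word)
splits n = concatMap (λ k → cartesianProduct (𝒮₁₃₂ k) (𝒮₁₃₂ (n ∸ k))) (upTo (suc n))

∈-splits⁻ : ∀ n {L R} → (L , R) ∈ splits n → ∃[ k ] k ≤ n × Av k L × Av (n ∸ k) R
∈-splits⁻ n LR∈ with find (∈-concatMap⁻ (λ k → cartesianProduct (𝒮₁₃₂ k) (𝒮₁₃₂ (n ∸ k))) {xs = upTo (suc n)} LR∈)
... | k , k∈ , LR∈′ with ∈-cartesianProduct⁻ (𝒮₁₃₂ k) (𝒮₁₃₂ (n ∸ k)) LR∈′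
...   | L∈ , R∈ = k , ℕₚ.≤-pred (∈-upTo⁻ k∈) , ∈-𝒮⁻ k L∈ , ∈-𝒮⁻ (n ∸ k) R∈

∈-splits⁺ : ∀ {k l L R} → Av k L → Av l R → (L , R) ∈ splits (k ℕ.+ l)
∈-splits⁺ {k} {l} {R = R} avL avR = ∈-concatMap⁺ (λ i → cartesianProduct (𝒮₁₃₂ i) (𝒮₁₃₂ (k ℕ.+ l ∸ i)))
  (lose (∈-upTo⁺ (s≤s (ℕₚ.m≤m+n k l)))
    (∈-cartesianProduct⁺ (∈-𝒮⁺ k avL) (∈-𝒮⁺ (k ℕ.+ l ∸ k) (subst (λ j → Av j R) (≡.sym (ℕₚ.m+n∸m≡n k l)) avR))))

splits-unique : ∀ n → Unique (splits n)
splits-unique n = Unique-concatMap⁺ same-k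
  (λ k → Uniqueₚ.cartesianProduct⁺ (𝒮-unique k) (𝒮-unique (n ∸ k))) (Uniqueₚ.upTo⁺ (suc n))
  where
  same-k : ∀ {k k′ v} → k ∈ upTo (suc n) → k′ ∈ upTo (suc n) →
    v ∈ cartesianProduct (𝒮₁₃₂ k) (𝒮₁₃₂ (n ∸ k)) → v ∈ cartesianProduct (𝒮₁₃₂ k′) (𝒮₁₃₂ (n ∸ k′)) → k ≡ k′
  same-k {k} {k′} _ _ v∈ v∈′ = ≡.trans
    (≡.sym (Av.length≡ (∈-𝒮⁻ k (proj₁ (∈-cartesianProduct⁻ _ (𝒮₁₃₂ (n ∸ k)) v∈)))))
    (Av.length≡ (∈-𝒮⁻ k′ (proj₁ (∈-cartesianProduct⁻ _ (𝒮₁₃₂ (n ∸ k′)) v∈′))))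

𝒮-suc-↭ : ∀ n → 𝒮₁₃₂ (suc n) ↭ map glue (splits n)
𝒮-suc-↭ n = Unique-↭ (𝒮-unique (suc n)) (Unique-map⁺ injective (splits-unique n)) to from
  where
  injective : ∀ {y z} → y ∈ splits n → z ∈ splits n → glue y ≡ glue z → y ≡ z
  injective y∈ z∈ =
    let _ , k≤n , avL , avR = ∈-splits⁻ n y∈
        _ , k′≤n , avL′ , avR′ = ∈-splits⁻ n z∈
    in glue-injective avL avR avL′ avR′ (≡.trans (ℕₚ.m+[n∸m]≡n k≤n) (≡.sym (ℕₚ.m+[n∸m]≡n k′≤n)))
  to : ∀ {σ} → σ ∈ 𝒮₁₃₂ (suc n) → σ ∈ map glue (splits n)
  to σ∈ with glue-Av⁻ {n} (∈-𝒮⁻ (suc n) σ∈)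
  ... | L , R , ≡.refl , avL , avR , ≡.refl = ∈-map⁺ glue (∈-splits⁺ avL avR)
  from : ∀ {σ} → σ ∈ map glue (splits n) → σ ∈ 𝒮₁₃₂ (suc n)
  from σ∈ =
    let LR , LR∈ , σ≡ = ∈-map⁻ glue σ∈
        k , k≤n , avL , avR = ∈-splits⁻ n LR∈
    in subst (_∈ 𝒮₁₃₂ (suc n)) (≡.sym σ≡)
         (∈-𝒮⁺ (suc n) (subst (λ j → Av (suc j) (glue LR)) (ℕₚ.m+[n∸m]≡n k≤n) (glue-Av avL avR)))

module Enumeration {d δ} (δ-av : Av d δ) where

  open Matches (Av.isPerm δ-av) public

  ends? : Decidable Ends
  ends? L = red (drop (suc (length L) ∸ length γ) (L ∷ʳ suc (length L))) ≟ᵂ γ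

  Ends⇒⊖ : ∀ {k L} → Av k L → Ends L →
    ∃[ L′ ] Av (length L′) L′ × 0 < length L′ × L ≡ L′ ⊖ δ × length L′ ℕ.+ d ≡ k
  Ends⇒⊖ av ends with Ends⁻ av ends
  ... | L′ , avL′ , 0<|L′| , ≡.refl =
    L′ , avL′ , 0<|L′| , ≡.refl , ≡.trans (≡.sym (Av.length≡ (⊖-Av avL′ δ-av))) (Av.length≡ av)

  filter-ends-↭ : ∀ j → filter ends? (𝒮₁₃₂ (suc j ℕ.+ d)) ↭ map (_⊖ δ) (𝒮₁₃₂ (suc j))
  filter-ends-↭ j = Unique-↭ (Uniqueₚ.filter⁺ ends? (𝒮-unique (suc j ℕ.+ d)))
    (Uniqueₚ.map⁺ ⊖δ-injective (𝒮-unique (suc j))) to from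
    where
    ⊖δ-injective : ∀ {P P′} → P ⊖ δ ≡ P′ ⊖ δ → P ≡ P′
    ⊖δ-injective eq = map-injective (ℕₚ.+-cancelˡ-≡ (length δ) _ _) (++-cancelʳ δ _ _ eq)
    to : ∀ {σ} → σ ∈ filter ends? (𝒮₁₃₂ (suc j ℕ.+ d)) → σ ∈ map (_⊖ δ) (𝒮₁₃₂ (suc j))
    to σ∈ =
      let σ∈𝒮 , ends = ∈-filter⁻ ends? {xs = 𝒮₁₃₂ (suc j ℕ.+ d)} σ∈
          L , avL , _ , σ≡ , |L|+d≡ = Ends⇒⊖ (∈-𝒮⁻ (suc j ℕ.+ d) σ∈𝒮) ends
      in subst (_∈ map (_⊖ δ) (𝒮₁₃₂ (suc j))) (≡.sym σ≡)
           (∈-map⁺ (_⊖ δ) (∈-𝒮⁺ (suc j) (subst (λ k → Av k L) (ℕₚ.+-cancelʳ-≡ d _ _ |L|+d≡) avL)))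
    from : ∀ {σ} → σ ∈ map (_⊖ δ) (𝒮₁₃₂ (suc j)) → σ ∈ filter ends? (𝒮₁₃₂ (suc j ℕ.+ d))
    from σ∈ with ∈-map⁻ (_⊖ δ) σ∈
    ... | L , L∈ , ≡.refl = ∈-filter⁺ ends? (∈-𝒮⁺ (suc j ℕ.+ d) (⊖-Av (∈-𝒮⁻ (suc j) L∈) δ-av)) (Ends⁺ (∈-𝒮⁻ (suc j) L∈))

  -- The prefix `L′` is nonempty and δ takes up d letters, so d + 1 is the least length at which a
  -- match can be completed.
  filter-ends-[] : ∀ {k} → k ≤ d → filter ends? (𝒮₁₃₂ k) ≡ []
  filter-ends-[] {k} k≤d = filter-none ends? (All.tabulate no-end)
    where
    no-end : ∀ {L} → L ∈ 𝒮₁₃₂ k → ¬ Ends L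
    no-end L∈ ends = let _ , _ , 0<|L′| , _ , |L′|+d≡k = Ends⇒⊖ (∈-𝒮⁻ k L∈) ends in
      ℕₚ.<⇒≱ (ℕₚ.m<n+m d 0<|L′|) (ℕₚ.≤-trans (ℕₚ.≤-reflexive |L′|+d≡k) k≤d)

  -- The equation for the generating function

  module GeneratingFunction {c ℓ} (K : CommutativeRing c ℓ) (X : CommutativeRing.Carrier K) where

    open CommutativeRing K hiding (zero)
    open Sums K
    open SeriesRing K
    open SetoidReasoning setoid
    open import Algebra.Properties.Semiring.Exp semiring using (_^_; ^-homo-*)
    private module S = CommutativeRing seriesRing
    open PowerSeries rawRing using (Series; const) renaming (indeterminate to t)
    open Ops S.rawRing using () renaming (_^_ to _^ˢ_)

    X^ : Word → Carrier
    X^ σ = X ^ mch γ σ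

    -- The left factor of the recursion is `a`, which weighs a block together with its maximum; `e`
    -- collects the blocks where that maximum completes a match, so a = b + (X - 1) e.
    b a e : Series
    b n = Σ[ 𝒮₁₃₂ n ] X^
    a n = Σ[ 𝒮₁₃₂ n ] (λ L → X^ (L ∷ʳ suc (length L)))
    e n = Σ[ filter ends? (𝒮₁₃₂ n) ] X^

    T : Series
    T = t ^ˢ d

    b-zero : b 0 ≈ 1#
    b-zero = trans (+-identityʳ _) (reflexive (cong (X ^_) (mch-[] (suc d) (δ ∷ʳ suc (suc d)))))

    b-suc : ∀ n → b (suc n) ≈ (a S.* b) n
    b-suc n = begin
      Σ[ 𝒮₁₃₂ (suc n) ] X^
        ≈⟨ ∑-↭ (𝒮-suc-↭ n) X^ ⟩
      Σ[ map glue (splits n) ] X^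
        ≈⟨ reflexive (∑-map glue (splits n)) ⟩
      Σ[ splits n ] (X^ ∘ glue)
        ≈⟨ ∑-concatMap (λ k → cartesianProduct (𝒮₁₃₂ k) (𝒮₁₃₂ (n ∸ k))) (upTo (suc n)) (X^ ∘ glue) ⟩
      Σ[ upTo (suc n) ] (λ k → Σ[ cartesianProduct (𝒮₁₃₂ k) (𝒮₁₃₂ (n ∸ k)) ] (X^ ∘ glue))
        ≈⟨ ∑-cong (upTo (suc n)) (λ {k} _ → ∑-cartesianProductWith _,_ (𝒮₁₃₂ k) (𝒮₁₃₂ (n ∸ k)) (λ {L} {R} L∈ R∈ →
             trans (reflexive (cong (X ^_) (mch-glue (∈-𝒮⁻ k L∈) (∈-𝒮⁻ (n ∸ k) R∈))))
                   (^-homo-* X (mch γ (L ∷ʳ suc (length L))) (mch γ R)))) ⟩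
      (a S.* b) n ∎

    split-off : ∀ p → X * p ≈ p + (X - 1#) * p
    split-off p = sym (begin
      p + (X - 1#) * p         ≈⟨ +-congʳ (*-identityˡ p) ⟨
      1# * p + (X - 1#) * p    ≈⟨ distribʳ p 1# (X - 1#) ⟨
      (1# + (X - 1#)) * p      ≈⟨ *-congʳ (+-comm 1# (X - 1#)) ⟩
      (X - 1# + 1#) * p        ≈⟨ *-congʳ (+-assoc X (- 1#) 1#) ⟩
      (X + (- 1# + 1#)) * p    ≈⟨ *-congʳ (+-congˡ (-‿inverseˡ 1#)) ⟩
      (X + 0#) * p             ≈⟨ *-congʳ (+-identityʳ X) ⟩
      X * p                    ∎)

    a-split : ∀ n → a n ≈ b n + (X - 1#) * e n
    a-split n = trans (∑-filter ends? (𝒮₁₃₂ n) ends-≈ no-ends-≈) (+-congˡ (∑-*ˡ (filter ends? (𝒮₁₃₂ n)) (X - 1#) X^))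
      where
      last-window : Word → Word
      last-window L = drop (suc (length L) ∸ length γ) (L ∷ʳ suc (length L))
      ends-≈ : ∀ {L} → Ends L → X^ (L ∷ʳ suc (length L)) ≈ X^ L + (X - 1#) * X^ L
      ends-≈ {L} ends = trans (reflexive (cong (X ^_) (≡.trans (mch-∷ʳ-max L)
        (≡.trans (cong (mch γ L ℕ.+_) (hit-yes γ (last-window L) ends)) (ℕₚ.+-comm (mch γ L) 1))))) (split-off (X^ L))
      no-ends-≈ : ∀ {L} → ¬ Ends L → X^ (L ∷ʳ suc (length L)) ≈ X^ L
      no-ends-≈ {L} ¬ends = reflexive (cong (X ^_) (≡.trans (mch-∷ʳ-max L)
        (≡.trans (cong (mch γ L ℕ.+_) (hit-no γ (last-window L) ¬ends)) (ℕₚ.+-identityʳ (mch γ L)))))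

    e-small : ∀ {k} → k ≤ d → e k ≈ 0#
    e-small k≤d = reflexive (cong (λ w → Σ[ w ] X^) (filter-ends-[] k≤d))

    e-large : ∀ j → e (suc j ℕ.+ d) ≈ b (suc j)
    e-large j = begin
      e (suc j ℕ.+ d)
        ≈⟨ ∑-↭ (filter-ends-↭ j) X^ ⟩
      Σ[ map (_⊖ δ) (𝒮₁₃₂ (suc j)) ] X^
        ≈⟨ reflexive (∑-map (_⊖ δ) (𝒮₁₃₂ (suc j))) ⟩
      Σ[ 𝒮₁₃₂ (suc j) ] (X^ ∘ (_⊖ δ))
        ≈⟨ ∑-cong (𝒮₁₃₂ (suc j)) (λ L∈ → reflexive (cong (X ^_) (mch-⊖δ (∈-𝒮⁻ (suc j) L∈) δ-av))) ⟩
      b (suc j) ∎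

    b-1 : Series
    b-1 = b S.- S.1#

    -- Removing δ lowers the length by d, which is the factor t^d; subtracting 1 discards the empty
    -- prefix.
    e≈T*[b-1] : e S.≈ T S.* b-1
    e≈T*[b-1] n with n ℕₚ.≤? d
    ... | yes n≤d = trans (e-small n≤d) (sym (low n≤d))
      where
      b-1-zero : b-1 0 ≈ 0#
      b-1-zero = trans (+-congʳ b-zero) (-‿inverseʳ 1#)
      low : n ≤ d → (T S.* b-1) n ≈ 0#
      low = t^-low b-1 b-1-zero d n
    ... | no n≰d with ℕₚ.m≤n⇒∃[o]m+o≡n (ℕₚ.≰⇒> n≰d)
    ...   | j , ≡.refl = trans (reflexive (cong e swap))
      (trans (e-large j) (sym (trans (reflexive (cong (T S.* b-1) swap)) high)))
      where
      open import Algebra.Properties.Ring ring using (-0#≈0#)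
      swap : suc d ℕ.+ j ≡ suc j ℕ.+ d
      swap = cong suc (ℕₚ.+-comm d j)
      high : (T S.* b-1) (suc j ℕ.+ d) ≈ b (suc j)
      high = trans (t^-high b-1 d (suc j)) (trans (+-congˡ -0#≈0#) (+-identityʳ _))

    x-1-coeff : (const X S.- S.1#) S.≈ const (X - 1#)
    x-1-coeff zero    = refl
    x-1-coeff (suc n) = -‿inverseʳ 0#

    b-equation : b S.≈ S.1# S.+ t S.* ((b S.+ (const X S.- S.1#) S.* (T S.* b-1)) S.* b)
    b-equation zero    = trans b-zero (sym (trans
      (+-congˡ (t-*-zero ((b S.+ (const X S.- S.1#) S.* (T S.* b-1)) S.* b))) (+-identityʳ 1#)))
    b-equation (suc n) = begin
      b (suc n)
        ≈⟨ b-suc n ⟩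
      (a S.* b) n
        ≈⟨ S.*-congʳ {b} a≈ n ⟩
      (c′ S.* b) n
        ≈⟨ t-*-suc (c′ S.* b) n ⟨
      (t S.* (c′ S.* b)) (suc n)
        ≈⟨ +-identityˡ _ ⟨
      0# + (t S.* (c′ S.* b)) (suc n) ∎
      where
      c′ : Series
      c′ = b S.+ (const X S.- S.1#) S.* (T S.* b-1)
      a≈ : a S.≈ c′
      a≈ k = trans (a-split k) (+-congˡ (trans (sym (const-* (X - 1#) e k))
        (S.*-cong (S.sym x-1-coeff) e≈T*[b-1] k)))

    -- The product `t S.* T` is by definition `t ^ˢ suc d`, the power t^(m-1) of the theorem.
    b-closed-form : Ops._≈_/_ S.rawRing b (S.1# S.+ (t S.* T) S.* (const X S.- S.1#) S.* (b ^ˢ 2 S.- b)) (S.1# S.- t S.* b)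
    b-closed-form = solve-quadratic seriesRing b-equation (proj₂ (Inverse.1-t*-invertible K b))

-- The shape of γ and the conclusion

last-∷ʳ : ∀ (xs : List A) y → last (xs ∷ʳ y) ≡ just y
last-∷ʳ []           y = ≡.refl
last-∷ʳ (x ∷ [])     y = ≡.refl
last-∷ʳ (_ ∷ x ∷ xs) y = last-∷ʳ (x ∷ xs) y

γ-shape : ∀ {d γ} → Av (suc (suc d)) γ → head γ ≡ just (suc d) → last γ ≡ just (suc (suc d)) →
  ∃[ δ ] Av d δ × γ ≡ suc d ∷ δ ∷ʳ suc (suc d)
γ-shape {γ = g ∷ γ′} av h l with initLast γ′
... | [] = contradiction (Av.length≡ av) λ ()
... | δ ∷ʳ′ g′ with just-injective h | just-injective (≡.trans (≡.sym (last-∷ʳ (g ∷ δ) g′)) l)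
...   | ≡.refl | ≡.refl = δ , record
        { isPerm = record
          { length≡ = ℕₚ.suc-injective (ℕₚ.suc-injective (≡.trans (cong suc (≡.sym (length-∷ʳ δ _))) (Av.length≡ av)))
          ; unique  = Unique-⊆ δ⊆γ (Av.unique av)
          ; bounds  = λ a∈δ → Av.positive av (δ∈γ a∈δ)
              -- Letters are at most d+2; being distinct from the last letter d+2 and the first
              -- letter d+1 brings the bound down to d.
              , ℕₚ.≤-pred (ℕₚ.≤∧≢⇒< (ℕₚ.≤-pred (ℕₚ.≤∧≢⇒< (Av.bounded av (δ∈γ a∈δ))
                  (Unique-++⇒≢ (_ ∷ δ) (Av.unique av) (there a∈δ) (here ≡.refl))))
                  (Unique-++⇒≢ [ _ ] (Av.unique av) (here ≡.refl) (∈-++⁺ˡ a∈δ) ∘ ≡.sym))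
          }
        ; avoids = Avoids132-⊆ δ⊆γ (Av.avoids av)
        } , ≡.refl
  where
  δ⊆γ : δ ⊆ g ∷ δ ∷ʳ g′
  δ⊆γ = skip g (Sublist.++⁺ʳ _ ⊆-refl)
  δ∈γ : ∀ {a} → a ∈ δ → a ∈ g ∷ δ ∷ʳ g′
  δ∈γ = there ∘ ∈-++⁺ˡ

open import Defs

theorem14 : ∀ (m : ℕ) (γ : Word) → 2 ≤ m →
    γ ∈ 𝒮 m (1 ∷ 3 ∷ 2 ∷ []) → head γ ≡ just (m ∸ 1) → last γ ≡ just m →
    B γ ≈ (1# + t ^ (m ∸ 1) * (x - 1#) * (B γ ^ 2 - B γ)) / (1# - t * B γ)
theorem14 (suc (suc d)) γ (s≤s (s≤s _)) γ∈ h l with γ-shape (∈-𝒮⁻ (suc (suc d)) γ∈) h l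
-- The rings built here have as operations the very ones of the statement, so the closed form over K
-- = ℚ[x] is the claim up to unfolding.
... | δ , δ-av , ≡.refl = Enumeration.GeneratingFunction.b-closed-form δ-av
  (PolynomialRing.polynomialRing ℚₚ.+-*-commutativeRing)
  (Polynomial.indeterminate (CommutativeRing.rawRing ℚₚ.+-*-commutativeRing))
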